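{- For every (finite) distributive lattice $L$, the VC-dimension of $L$ equals its Euclidean dimension: $\mathrm{VC\text{ - }dim}(L)=\dim_{\mathbb{E}}(L)$.
   Context: A finite distributive lattice $L$ is viewed as a set family via Birkhoff's theorem: $L$ is identified with the family $\mathcal{D}_P\subseteq 2^U$ of all ideals (downward closed subsets) of the poset $P=(U,\leq)$ of its join-irreducible elements. The VC-dimension of a family $\mathcal{S}\subseteq 2^U$ is the maximum size of $X\subseteq U$ with $\{S\cap X:S\in\mathcal{S}\}=2^X$. A realization of a family $\mathcal{S}\subseteq 2^U$ in $\mathbb{R}^m$ consists of oriented affine hyperplanes $(H_e)_{e\in U}$ of $\mathbb{R}^m$, where $H_e=\{x:a_e\cdot x=b_e\}$ with $a_e\neq 0$, $H_e^+=\{x:a_e\cdot x>b_e\}$, $H_e^-=\{x:a_e\cdot x<b_e\}$, and a relatively open convex set $K\subseteq\mathbb{R}^m$ such that $X\subseteq U$ belongs to $\mathcal{S}$ if and only if there is $x\in K$ with $x\in H_e^+$ for all $e\in X$ and $x\in H_e^-$ for all $e\in U\setminus X$. The Euclidean dimension $\dim_{\mathbb{E}}(\mathcal{S})$ is the smallest $m$ such that $\mathcal{S}$ has a realization in $\mathbb{R}^m$. -}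

module Defs where

open import Data.Bool.Base using (Bool; true; T; _∧_)
open import Data.Fin.Base using (Fin)
open import Data.Nat.Base as ℕ using (ℕ; _⊔_)
import Data.Nat.Properties as ℕ
open import Data.Product.Base using (Σ; ∃; ∃-syntax; _×_; _,_; proj₁)
open import Data.Rational.Base as ℚ using (ℚ; 0ℚ; 1ℚ; ½; ∣_∣)
import Data.Rational.Properties as ℚ
open import Data.Rational.Solver using (module +-*-Solver)
open import Data.Sum.Base using (_⊎_)
open import Data.Vec.Functional using (Vector; foldr; zipWith)
open import Function.Bundles using (Func; Inverse; _⇔_)
open import Level using (Level; 0ℓ) renaming (suc to lsuc; _⊔_ to _⊔ˡ_)
open import Relation.Binary.Bundles using (Setoid; Poset)
import Relation.Binary.Construct.On as On
open import Relation.Binary.Core using (Rel)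
open import Relation.Binary.Definitions using (Minimum; _Respects_)
open import Relation.Binary.Lattice.Bundles using (DistributiveLattice)
open import Relation.Binary.PropositionalEquality
  using (_≡_; refl; sym; trans; cong; cong₂; subst)
import Relation.Binary.PropositionalEquality.Properties as ≡
open import Relation.Nullary.Negation.Core using (¬_)
open import Relation.Unary using (Pred)

private
  variable
    c ℓ ℓ₁ ℓ₂ : Level

-- Real numbers: Cauchy sequences of rationals, with the operations
-- taken termwise and the usual setoid equality _≈ᴿ_.

IsCauchy : (ℕ → ℚ) → Set
IsCauchy x = ∀ ε → 0ℚ ℚ.< ε →
  ∃[ N ] (∀ m n → N ℕ.≤ m → N ℕ.≤ n → ∣ x m ℚ.- x n ∣ ℚ.< ε)

record ℝ : Set where
  constructor mkℝ
  field
    seq      : ℕ → ℚ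
    isCauchy : IsCauchy seq

open ℝ public

private
  half : ℚ → ℚ
  half ε = ½ ℚ.* ε

  half-pos : ∀ {ε} → 0ℚ ℚ.< ε → 0ℚ ℚ.< half ε
  half-pos {ε} ε>0 = ℚ.positive⁻¹ (half ε)
    {{ℚ.pos*pos⇒pos ½ ε {{ℚ.positive ε>0}}}}

  half+half : ∀ ε → half ε ℚ.+ half ε ≡ ε
  half+half = solve 1 (λ ε → con ½ :* ε :+ con ½ :* ε := ε) refl
    where open +-*-Solver

  ∣+∣< : ∀ p q {δ ε} → ∣ p ∣ ℚ.< δ → ∣ q ∣ ℚ.< ε → ∣ p ℚ.+ q ∣ ℚ.< δ ℚ.+ ε
  ∣+∣< p q p<δ q<ε =
    ℚ.≤-<-trans (ℚ.∣p+q∣≤∣p∣+∣q∣ p q) (ℚ.+-mono-< p<δ q<ε)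

  ∣*∣< : ∀ p q {δ ε} → 0ℚ ℚ.< δ →
         ∣ p ∣ ℚ.< δ → ∣ q ∣ ℚ.< ε → ∣ p ℚ.* q ∣ ℚ.< δ ℚ.* ε
  ∣*∣< p q {δ} {ε} δ>0 p<δ q<ε = begin-strict
    ∣ p ℚ.* q ∣       ≡⟨ ℚ.∣p*q∣≡∣p∣*∣q∣ p q ⟩
    ∣ p ∣ ℚ.* ∣ q ∣   ≤⟨ ℚ.*-monoʳ-≤-nonNeg ∣ q ∣ {{ℚ.∣-∣-nonNeg q}} (ℚ.<⇒≤ p<δ) ⟩
    δ ℚ.* ∣ q ∣       <⟨ ℚ.*-monoʳ-<-pos δ {{ℚ.positive δ>0}} q<ε ⟩
    δ ℚ.* ε           ∎
    where open ℚ.≤-Reasoning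

  quotient : ∀ B ε → 0ℚ ℚ.< B → 0ℚ ℚ.< ε → ∃[ δ ] (0ℚ ℚ.< δ × B ℚ.* δ ≡ ε)
  quotient B ε B>0 ε>0 = δ , δ>0 , B*δ≡ε
    where
    instance
      B-pos : ℚ.Positive B
      B-pos = ℚ.positive B>0
      B-nz : ℚ.NonZero B
      B-nz = ℚ.pos⇒nonZero B
    δ = (ℚ.1/ B) ℚ.* ε
    δ>0 : 0ℚ ℚ.< δ
    δ>0 = ℚ.positive⁻¹ δ
      {{ℚ.pos*pos⇒pos (ℚ.1/ B) {{ℚ.1/pos⇒pos B}} ε {{ℚ.positive ε>0}}}}
    B*δ≡ε : B ℚ.* δ ≡ ε
    B*δ≡ε = trans (sym (ℚ.*-assoc B (ℚ.1/ B) ε))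
           (trans (cong (ℚ._* ε) (ℚ.*-inverseʳ B)) (ℚ.*-identityˡ ε))

  eventually-bounded : ∀ x → IsCauchy x →
    ∃[ B ] ∃[ N ] (0ℚ ℚ.< B × (∀ n → N ℕ.≤ n → ∣ x n ∣ ℚ.< B))
  eventually-bounded x x-cauchy with x-cauchy 1ℚ (ℚ.positive⁻¹ 1ℚ)
  ... | N , close = B , N , B>0 , bound
    where
    B = 1ℚ ℚ.+ (1ℚ ℚ.+ ∣ x N ∣)
    p<1+p : ∀ p → p ℚ.< 1ℚ ℚ.+ p
    p<1+p p = subst (ℚ._< 1ℚ ℚ.+ p) (ℚ.+-identityˡ p)
      (ℚ.+-monoˡ-< p (ℚ.positive⁻¹ 1ℚ))
    split : ∀ p q → (p ℚ.- q) ℚ.+ q ≡ p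
    split = solve 2 (λ p q → (p :- q) :+ q := p) refl
      where open +-*-Solver
    bound : ∀ n → N ℕ.≤ n → ∣ x n ∣ ℚ.< B
    bound n N≤n = subst (λ p → ∣ p ∣ ℚ.< B) (split (x n) (x N))
      (∣+∣< (x n ℚ.- x N) (x N) (close n N N≤n ℕ.≤-refl) (p<1+p ∣ x N ∣))
    B>0 : 0ℚ ℚ.< B
    B>0 = ℚ.≤-<-trans (ℚ.0≤∣p∣ (x N)) (bound N ℕ.≤-refl)

  -- Abstract because unfolding these proofs makes later checks blow up.
  abstract
    const-cauchy : ∀ q → IsCauchy (λ _ → q)
    const-cauchy q ε ε>0 = 0 , λ _ _ _ _ →
      subst (λ p → ∣ p ∣ ℚ.< ε) (sym (ℚ.+-inverseʳ q)) ε>0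

    +-cauchy : ∀ x y → IsCauchy x → IsCauchy y → IsCauchy (λ n → x n ℚ.+ y n)
    +-cauchy x y x-cauchy y-cauchy ε ε>0
      with x-cauchy (half ε) (half-pos ε>0) | y-cauchy (half ε) (half-pos ε>0)
    ... | N₁ , x-close | N₂ , y-close = N₁ ⊔ N₂ , close
      where
      regroup : ∀ a b c d → (a ℚ.- c) ℚ.+ (b ℚ.- d) ≡ (a ℚ.+ b) ℚ.- (c ℚ.+ d)
      regroup = solve 4
        (λ a b c d → (a :- c) :+ (b :- d) := (a :+ b) :- (c :+ d)) refl
        where open +-*-Solver
      close : ∀ m n → N₁ ⊔ N₂ ℕ.≤ m → N₁ ⊔ N₂ ℕ.≤ n →
              ∣ (x m ℚ.+ y m) ℚ.- (x n ℚ.+ y n) ∣ ℚ.< ε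
      close m n N≤m N≤n =
        subst (λ p → ∣ p ∣ ℚ.< ε) (regroup (x m) (y m) (x n) (y n))
        (subst (∣ (x m ℚ.- x n) ℚ.+ (y m ℚ.- y n) ∣ ℚ.<_) (half+half ε)
        (∣+∣< (x m ℚ.- x n) (y m ℚ.- y n)
          (x-close m n (ℕ.m⊔n≤o⇒m≤o N₁ N₂ N≤m) (ℕ.m⊔n≤o⇒m≤o N₁ N₂ N≤n))
          (y-close m n (ℕ.m⊔n≤o⇒n≤o N₁ N₂ N≤m) (ℕ.m⊔n≤o⇒n≤o N₁ N₂ N≤n))))

    neg-cauchy : ∀ x → IsCauchy x → IsCauchy (λ n → ℚ.- x n)
    neg-cauchy x x-cauchy ε ε>0 with x-cauchy ε ε>0
    ... | N , x-close = N , λ m n N≤m N≤n →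
      subst (ℚ._< ε)
        (trans (sym (ℚ.∣-p∣≡∣p∣ (x m ℚ.- x n))) (cong ∣_∣ (regroup (x m) (x n))))
        (x-close m n N≤m N≤n)
      where
      regroup : ∀ a b → ℚ.- (a ℚ.- b) ≡ (ℚ.- a) ℚ.- (ℚ.- b)
      regroup = solve 2 (λ a b → :- (a :- b) := (:- a) :- (:- b)) refl
        where open +-*-Solver

    *-regroup : ∀ a b c d →
      a ℚ.* (b ℚ.- d) ℚ.+ d ℚ.* (a ℚ.- c) ≡ a ℚ.* b ℚ.- c ℚ.* d
    *-regroup = solve 4
      (λ a b c d → a :* (b :- d) :+ d :* (a :- c) := a :* b :- c :* d) refl
      where open +-*-Solver

    *-close : ∀ a b c d {B C δ η ε} → 0ℚ ℚ.< B → 0ℚ ℚ.< C →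
      B ℚ.* η ≡ half ε → C ℚ.* δ ≡ half ε →
      ∣ a ∣ ℚ.< B → ∣ d ∣ ℚ.< C → ∣ a ℚ.- c ∣ ℚ.< δ → ∣ b ℚ.- d ∣ ℚ.< η →
      ∣ a ℚ.* b ℚ.- c ℚ.* d ∣ ℚ.< ε
    *-close a b c d {B} {C} {δ} {η} {ε} B>0 C>0 B*η≡ C*δ≡ a<B d<C ac<δ bd<η =
      begin-strict
      ∣ a ℚ.* b ℚ.- c ℚ.* d ∣                      ≡⟨ cong ∣_∣ (*-regroup a b c d) ⟨
      ∣ a ℚ.* (b ℚ.- d) ℚ.+ d ℚ.* (a ℚ.- c) ∣      <⟨ ∣+∣< (a ℚ.* (b ℚ.- d)) (d ℚ.* (a ℚ.- c))
                                                        (∣*∣< a (b ℚ.- d) B>0 a<B bd<η)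
                                                        (∣*∣< d (a ℚ.- c) C>0 d<C ac<δ) ⟩
      B ℚ.* η ℚ.+ C ℚ.* δ                          ≡⟨ cong₂ ℚ._+_ B*η≡ C*δ≡ ⟩
      half ε ℚ.+ half ε                            ≡⟨ half+half ε ⟩
      ε                                            ∎
      where open ℚ.≤-Reasoning

    *-cauchy : ∀ x y → IsCauchy x → IsCauchy y → IsCauchy (λ n → x n ℚ.* y n)
    *-cauchy x y x-cauchy y-cauchy ε ε>0 =
      let B , M₁ , B>0 , ∣x∣<B = eventually-bounded x x-cauchy
          C , M₂ , C>0 , ∣y∣<C = eventually-bounded y y-cauchy
          δ , δ>0 , C*δ≡ = quotient C (half ε) C>0 (half-pos ε>0)
          η , η>0 , B*η≡ = quotient B (half ε) B>0 (half-pos ε>0)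
          N₁ , x-close = x-cauchy δ δ>0
          N₂ , y-close = y-cauchy η η>0
          M = M₁ ⊔ M₂
          N = N₁ ⊔ N₂
      in M ⊔ N , λ m n ≤m ≤n →
        *-close (x m) (y m) (x n) (y n) B>0 C>0 B*η≡ C*δ≡
          (∣x∣<B m (ℕ.m⊔n≤o⇒m≤o M₁ M₂ (ℕ.m⊔n≤o⇒m≤o M N ≤m)))
          (∣y∣<C n (ℕ.m⊔n≤o⇒n≤o M₁ M₂ (ℕ.m⊔n≤o⇒m≤o M N ≤n)))
          (x-close m n (ℕ.m⊔n≤o⇒m≤o N₁ N₂ (ℕ.m⊔n≤o⇒n≤o M N ≤m))
                       (ℕ.m⊔n≤o⇒m≤o N₁ N₂ (ℕ.m⊔n≤o⇒n≤o M N ≤n)))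
          (y-close m n (ℕ.m⊔n≤o⇒n≤o N₁ N₂ (ℕ.m⊔n≤o⇒n≤o M N ≤m))
                       (ℕ.m⊔n≤o⇒n≤o N₁ N₂ (ℕ.m⊔n≤o⇒n≤o M N ≤n)))

infix  4 _≈ᴿ_ _<ᴿ_ _≤ᴿ_
infixl 6 _+ᴿ_ _-ᴿ_
infixl 7 _*ᴿ_
infix  8 -ᴿ_

fromℚ : ℚ → ℝ
fromℚ q = mkℝ (λ _ → q) (const-cauchy q)

0ᴿ 1ᴿ : ℝ
0ᴿ = fromℚ 0ℚ
1ᴿ = fromℚ 1ℚ

_+ᴿ_ _*ᴿ_ : ℝ → ℝ → ℝ
x +ᴿ y = mkℝ (λ n → seq x n ℚ.+ seq y n)
             (+-cauchy (seq x) (seq y) (isCauchy x) (isCauchy y))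
x *ᴿ y = mkℝ (λ n → seq x n ℚ.* seq y n)
             (*-cauchy (seq x) (seq y) (isCauchy x) (isCauchy y))

-ᴿ_ : ℝ → ℝ
-ᴿ x = mkℝ (λ n → ℚ.- seq x n) (neg-cauchy (seq x) (isCauchy x))

_-ᴿ_ : ℝ → ℝ → ℝ
x -ᴿ y = x +ᴿ (-ᴿ y)

_≈ᴿ_ _<ᴿ_ _≤ᴿ_ : Rel ℝ 0ℓ
x ≈ᴿ y = ∀ ε → 0ℚ ℚ.< ε →
  ∃[ N ] (∀ n → N ℕ.≤ n → ∣ seq x n ℚ.- seq y n ∣ ℚ.< ε)
x <ᴿ y = ∃[ ε ] (0ℚ ℚ.< ε ×
  ∃[ N ] (∀ n → N ℕ.≤ n → seq x n ℚ.+ ε ℚ.< seq y n))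
x ≤ᴿ y = ¬ (y <ᴿ x)

ℝ^ : ℕ → Set
ℝ^ m = Vector ℝ m

infix 4 _≈ᵛ_
infixl 7 _·_

_≈ᵛ_ : ∀ {m} → Rel (ℝ^ m) 0ℓ
x ≈ᵛ y = ∀ i → x i ≈ᴿ y i

0ᵛ : ∀ {m} → ℝ^ m
0ᵛ _ = 0ᴿ

sum : ∀ {k} → Vector ℝ k → ℝ
sum = foldr _+ᴿ_ 0ᴿ

_·_ : ∀ {m} → ℝ^ m → ℝ^ m → ℝ
a · x = sum (zipWith _*ᴿ_ a x)

H⁺ H⁻ : ∀ {m} → ℝ^ m → ℝ → Pred (ℝ^ m) 0ℓ
H⁺ a b x = b <ᴿ a · x
H⁻ a b x = a · x <ᴿ b

Convex : ∀ {m} → Pred (ℝ^ m) 0ℓ → Set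
Convex K = ∀ x y → K x → K y → ∀ t → 0ᴿ ≤ᴿ t → t ≤ᴿ 1ᴿ →
  K (λ i → t *ᴿ x i +ᴿ (1ᴿ -ᴿ t) *ᴿ y i)

AffineHull : ∀ {m} → Pred (ℝ^ m) 0ℓ → Pred (ℝ^ m) 0ℓ
AffineHull {m} K y =
  ∃[ k ] Σ (Fin k → ℝ^ m) λ p → Σ (Fin k → ℝ) λ t →
    (∀ i → K (p i)) × sum t ≈ᴿ 1ᴿ × y ≈ᵛ (λ j → sum (λ i → t i *ᴿ p i j))

-- Open in the affine hull, for the product topology of ℝᵐ: the boxes
-- centred at x form a neighbourhood basis of x.
RelativelyOpen : ∀ {m} → Pred (ℝ^ m) 0ℓ → Set
RelativelyOpen K = ∀ x → K x → ∃[ ε ] (0ᴿ <ᴿ ε ×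
  (∀ y → AffineHull K y →
    (∀ i → (-ᴿ ε <ᴿ y i -ᴿ x i) × (y i -ᴿ x i <ᴿ ε)) → K y))

-- Members of the power set 2^U are Bool-valued functions respecting the
-- equality of U.

module _ (U : Setoid c ℓ) where
  private module U = Setoid U

  Subset : Set (c ⊔ˡ ℓ)
  Subset = Func U (≡.setoid Bool)

module _ {U : Setoid c ℓ} where
  private module U = Setoid U

  infix  4 _∈_ _∉_ _⊆_ _≐_
  infixr 7 _∩_

  _∈_ _∉_ : U.Carrier → Subset U → Set
  e ∈ X = T (Func.to X e)
  e ∉ X = ¬ (e ∈ X)

  _⊆_ _≐_ : Rel (Subset U) c
  X ⊆ Y = ∀ e → e ∈ X → e ∈ Y
  X ≐ Y = ∀ e → e ∈ X ⇔ e ∈ Y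

  _∩_ : Subset U → Subset U → Subset U
  X ∩ Y = record
    { to   = λ e → Func.to X e ∧ Func.to Y e
    ; cong = λ e≈f → cong₂ _∧_ (Func.cong X e≈f) (Func.cong Y e≈f)
    }

  elements : Subset U → Setoid c ℓ
  elements X = On.setoid {B = Σ U.Carrier (_∈ X)} U proj₁

  HasSize : Subset U → ℕ → Set (c ⊔ˡ ℓ)
  HasSize X k = Inverse (≡.setoid (Fin k)) (elements X)

  -- { S ∩ X : S ∈ 𝒮 } = 2^X
  Shatters : Pred (Subset U) ℓ₁ → Subset U → Set (c ⊔ˡ ℓ ⊔ˡ ℓ₁)
  Shatters 𝒮 X = ∀ Y → (∃[ S ] (𝒮 S × (S ∩ X) ≐ Y)) ⇔ Y ⊆ X

  IsVCDimension : Pred (Subset U) ℓ₁ → ℕ → Set (c ⊔ˡ ℓ ⊔ˡ ℓ₁)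
  IsVCDimension 𝒮 d =
    (∃[ X ] (HasSize X d × Shatters 𝒮 X)) ×
    (∀ X k → HasSize X k → Shatters 𝒮 X → k ℕ.≤ d)

  record Realization (𝒮 : Pred (Subset U) ℓ₁) (m : ℕ)
         : Set (c ⊔ˡ ℓ ⊔ˡ ℓ₁ ⊔ˡ lsuc 0ℓ) where
    field
      a      : U.Carrier → ℝ^ m
      b      : U.Carrier → ℝ
      a-cong : ∀ {e f} → e U.≈ f → a e ≈ᵛ a f
      b-cong : ∀ {e f} → e U.≈ f → b e ≈ᴿ b f
      a≉0    : ∀ e → ¬ (a e ≈ᵛ 0ᵛ)
      K              : Pred (ℝ^ m) 0ℓ
      K-resp         : K Respects _≈ᵛ_
      K-convex       : Convex K
      K-relativeOpen : RelativelyOpen K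
      realizes       : ∀ X → 𝒮 X ⇔
        (∃[ x ] (K x × (∀ e → e ∈ X → H⁺ (a e) (b e) x)
                      × (∀ e → e ∉ X → H⁻ (a e) (b e) x)))

  IsEuclideanDimension : Pred (Subset U) ℓ₁ → ℕ → Set (c ⊔ˡ ℓ ⊔ˡ ℓ₁ ⊔ˡ lsuc 0ℓ)
  IsEuclideanDimension 𝒮 d =
    Realization 𝒮 d × (∀ m → Realization 𝒮 m → d ℕ.≤ m)

Ideals : (P : Poset c ℓ₁ ℓ₂) → Pred (Subset (Poset.Eq.setoid P)) (c ⊔ˡ ℓ₂)
Ideals P X = ∀ e f → e ≤ f → f ∈ X → e ∈ X
  where open Poset P using (_≤_)

record FiniteDistributiveLattice c ℓ₁ ℓ₂ : Set (lsuc (c ⊔ˡ ℓ₁ ⊔ˡ ℓ₂)) where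
  field
    distributiveLattice : DistributiveLattice c ℓ₁ ℓ₂

  open DistributiveLattice distributiveLattice public

  -- The library's lattices may be empty; a finite lattice here may not.
  field
    point       : Carrier
    size        : ℕ
    enumeration : Inverse (≡.setoid (Fin size)) setoid

module _ (L : FiniteDistributiveLattice c ℓ₁ ℓ₂) where
  open FiniteDistributiveLattice L

  JoinIrreducible : Pred Carrier (c ⊔ˡ ℓ₁ ⊔ˡ ℓ₂)
  JoinIrreducible j =
    ¬ (Minimum _≤_ j) × (∀ x y → j ≈ x ∨ y → j ≈ x ⊎ j ≈ y)

  -- The induced order; equality ignores the proofs of irreducibility.
  joinIrreducibles : Poset (c ⊔ˡ ℓ₁ ⊔ˡ ℓ₂) ℓ₁ ℓ₂
  joinIrreducibles = On.poset {B = Σ Carrier JoinIrreducible} poset proj₁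

  birkhoffFamily : Pred (Subset (Poset.Eq.setoid joinIrreducibles)) (c ⊔ˡ ℓ₁ ⊔ˡ ℓ₂)
  birkhoffFamily = Ideals joinIrreducibles

{-# OPTIONS --safe #-}

-- Both dimensions are the width d of the poset P of join-irreducibles. The
-- sets shattered by the ideals are the antichains of P. More than m affine
-- functionals on ℝᵐ have a combination that is constant, so they cannot take
-- all sign patterns; hence an antichain of size d forces m ≥ d. Conversely,
-- cover P by d chains (Dilworth), take the positive orthant of ℝᵈ as K, and
-- let H_e be Σᵢ M^(α e i) xᵢ = M^(N+1) with N = |P| and M = 2d + 1, where
-- α e i counts the elements of chain i above e, plus all elements off chain i
-- as a normalisation. Since α is antitone in e, every cell in the orthant is
-- an ideal. Since M is large the sum is governed by its largest term, and the
-- ideal X is the cell of the point with xᵢ = 2 M^(number of elements of X on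
-- chain i).

module Submission where

open import Defs
open import Algebra.Bundles using (CommutativeRing)
import Algebra.Properties.CommutativeMonoid.Sum as CommutativeMonoidSum
import Algebra.Properties.Semiring.Mult as SemiringMult
import Algebra.Properties.Semiring.Sum as SemiringSum
open import Data.Bool.Base using (Bool; true; false; T)
import Data.Bool.Properties as Bool
open import Data.Bool.Properties using (T?; T-∧)
open import Data.Fin.Base as Fin using (Fin; zero; suc; toℕ; fromℕ<; punchIn; punchOut)
import Data.Fin.Properties as Fin
open import Data.List.Base as List using (List; []; _∷_; filter; length)
open import Data.List.Membership.Propositional using (find; lose) renaming (_∈_ to _∈ˡ_)
open import Data.List.Membership.Propositional.Properties
  using (∈-allFin; ∈-filter⁺; ∈-filter⁻; ∈-map⁺)
import Data.List.Properties as List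
open import Data.List.Relation.Unary.Any as Any using (here; there)
import Data.List.Relation.Unary.Any.Properties as Any
open import Data.Nat.Base as ℕ using (ℕ; zero; suc; z≤n; s≤s)
open import Data.Nat.Induction using (<-wellFounded)
import Data.Nat.Properties as ℕ
open import Data.Product.Base using (Σ; ∃-syntax; _×_; _,_; proj₁; proj₂)
open import Data.Rational.Base as ℚ using (ℚ; 0ℚ; 1ℚ; ½; ∣_∣)
import Data.Rational.Properties as ℚ
open import Data.Rational.Solver using (module +-*-Solver)
open import Data.Sum.Base as Sum using (_⊎_; inj₁; inj₂; [_,_]′)
open import Data.Vec.Base as Vec using (Vec)
import Data.Vec.Functional as Vector
import Data.Vec.Functional.Properties as Vector
import Data.Vec.Properties as Vec
open import Function.Base using (id; _∘_)
open import Function.Bundles using (Equivalence; Func; Inverse; mk⇔)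
open import Function.Definitions using (Injective)
open import Induction.WellFounded using (Acc; acc)
open import Level using (Level; _⊔_)
open import Relation.Binary.Bundles using (Poset; Setoid)
open import Relation.Binary.Core using (Rel)
open import Relation.Binary.Definitions
  using (Decidable; Reflexive; Transitive; _Respects_; tri<; tri≈; tri>)
import Relation.Binary.Lattice.Properties.JoinSemilattice as JoinSemilattice
open import Relation.Binary.PropositionalEquality
  using (_≡_; _≢_; refl; sym; trans; cong; cong₂; subst; subst₂; module ≡-Reasoning)
open import Relation.Nullary.Decidable
  using (Dec; yes; no; does; ⌊_⌋; map′; ¬?; _×-dec_; _⊎-dec_; _→-dec_;
         decidable-stable; toWitness; fromWitness; isYes≗does; does-⇔)
open import Relation.Nullary.Negation using (¬_; contradiction)
open import Relation.Unary as Unary using (Pred)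

private
  module ∑ = SemiringSum (CommutativeRing.semiring ℚ.+-*-commutativeRing)
  module ∑ℕ = CommutativeMonoidSum ℕ.+-0-commutativeMonoid
  module ℚ× = SemiringMult (CommutativeRing.semiring ℚ.+-*-commutativeRing)
  variable
    ℓᵖ : Level

-- Dilworth's theorem

-- Descending search from a bound where `Q` fails. Applied to the sizes of antichains it produces
-- the width.
last-true : ∀ {q} {Q : ℕ → Set q} → Unary.Decidable Q → Q 0 → ∀ b → ¬ Q b →
            ∃[ d ] (Q d × ¬ Q (suc d))
last-true Q? Q0 zero    ¬Qb = contradiction Q0 ¬Qb
last-true Q? Q0 (suc b) ¬Qb with Q? b
... | yes Qb  = b , Qb , ¬Qb
... | no ¬Qb′ = last-true Q? Q0 b ¬Qb′

-- If `i` were missed, punching it out would embed `Fin (suc n)` into `Fin n`.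
injective⇒surjective : ∀ {n} (f : Fin n → Fin n) → Injective _≡_ _≡_ f →
                       ∀ i → ∃[ j ] f j ≡ i
injective⇒surjective {suc n} f f-injective i with Fin.any? (λ j → f j Fin.≟ i)
... | yes hit = hit
... | no ¬hit = contradiction (Fin.injective⇒≤ avoid-injective) ℕ.1+n≰n
  where
  i≢f : ∀ j → i ≢ f j
  i≢f j eq = ¬hit (j , sym eq)
  avoid-injective : Injective _≡_ _≡_ (λ j → punchOut (i≢f j))
  avoid-injective {j} {k} eq =
    f-injective (Fin.punchOut-injective (i≢f j) (i≢f k) eq)

module Dilworth {a ℓ} {A : Set a} (_≤_ : Rel A ℓ) (≤-refl : Reflexive _≤_)
                (≤-trans : Transitive _≤_) (_≤?_ : Decidable _≤_) where

  -- By reflexivity the last condition also makes the members distinct, so `k` is the true size.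
  Antichain : ℕ → List A → Set (a ⊔ ℓ)
  Antichain k xs = Σ (Fin k → A) λ v →
    (∀ i → v i ∈ˡ xs) × (∀ i j → v i ≤ v j → i ≡ j)

  -- The chains are the colour classes of `χ`. Values of `χ` off `xs` are arbitrary, and classes may
  -- be empty.
  ChainCover : ℕ → List A → Set (a ⊔ ℓ)
  ChainCover k xs = Σ (A → ℕ) λ χ →
    (∀ {x} → x ∈ˡ xs → χ x ℕ.< k) ×
    (∀ {x y} → x ∈ˡ xs → y ∈ˡ xs → χ x ≡ χ y → x ≤ y ⊎ y ≤ x)

  antichain-∷ : ∀ {k xs} x (v : Fin k → A) → x ∈ˡ xs → (∀ i → v i ∈ˡ xs) →
    (∀ i → ¬ x ≤ v i) → (∀ i → ¬ v i ≤ x) → (∀ i j → v i ≤ v j → i ≡ j) →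
    Antichain (suc k) xs
  antichain-∷ {k} {xs} x v x∈xs v∈xs x≰v v≰x v-antichain = w , w∈xs , w-antichain
    where
    w = x Vector.∷ v
    w∈xs : ∀ i → w i ∈ˡ xs
    w∈xs zero    = x∈xs
    w∈xs (suc i) = v∈xs i
    w-antichain : ∀ i j → w i ≤ w j → i ≡ j
    w-antichain zero    zero    _ = refl
    w-antichain zero    (suc j) p = contradiction p (x≰v j)
    w-antichain (suc i) zero    p = contradiction p (v≰x i)
    w-antichain (suc i) (suc j) p = cong suc (v-antichain i j p)

  -- Recursion on the size: once a first member is fixed, the others are sought among the entries
  -- incomparable to it.
  antichain? : ∀ k xs → Dec (Antichain k xs)
  antichain? zero    xs = yes ((λ ()) , (λ ()) , λ ())
  antichain? (suc k) xs =
    map′ assemble split (Any.any? (λ x → antichain? k (filter (incomparable? x) xs)) xs)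
    where
    incomparable? : ∀ x → Unary.Decidable (λ y → ¬ x ≤ y × ¬ y ≤ x)
    incomparable? x y = ¬? (x ≤? y) ×-dec ¬? (y ≤? x)
    assemble : Any.Any (λ x → Antichain k (filter (incomparable? x) xs)) xs →
               Antichain (suc k) xs
    assemble any with find any
    ... | x , x∈xs , v , v∈ , v-antichain =
      antichain-∷ x v x∈xs (proj₁ ∘ inc) (proj₁ ∘ proj₂ ∘ inc) (proj₂ ∘ proj₂ ∘ inc) v-antichain
      where
      inc : ∀ i → v i ∈ˡ xs × ¬ x ≤ v i × ¬ v i ≤ x
      inc i = ∈-filter⁻ (incomparable? x) (v∈ i)
    split : Antichain (suc k) xs →
            Any.Any (λ x → Antichain k (filter (incomparable? x) xs)) xs
    split (v , v∈xs , v-antichain) = lose (v∈xs zero)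
      ( v ∘ suc
      , (λ i → ∈-filter⁺ (incomparable? (v zero)) (v∈xs (suc i))
          ( (λ p → Fin.0≢1+n (v-antichain _ _ p))
          , (λ p → Fin.0≢1+n (sym (v-antichain _ _ p)))))
      , λ i j p → Fin.suc-injective (v-antichain (suc i) (suc j) p))

  antichain-⊆ : ∀ {k xs ys} → (∀ {x} → x ∈ˡ xs → x ∈ˡ ys) → Antichain k xs → Antichain k ys
  antichain-⊆ xs⊆ys (v , v∈xs , v-antichain) = v , (xs⊆ys ∘ v∈xs) , v-antichain

  -- Members found at the same position of the list are equal, hence comparable, so positions are
  -- distinct.
  antichain-bound : ∀ {k xs} → Antichain k xs → k ℕ.≤ length xs
  antichain-bound {k} {xs} (v , v∈xs , v-antichain) = Fin.injective⇒≤ index-injective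
    where
    index-injective : Injective _≡_ _≡_ (λ i → Any.index (v∈xs i))
    index-injective {i} {j} eq = v-antichain i j (subst (v i ≤_)
      (trans (Any.lookup-index (v∈xs i))
        (trans (cong (List.lookup xs) eq) (sym (Any.lookup-index (v∈xs j)))))
      ≤-refl)

  antichain-shrink : ∀ {j k xs} → j ℕ.≤ k → Antichain k xs → Antichain j xs
  antichain-shrink j≤k (v , v∈xs , v-antichain) =
    (λ i → v (Fin.inject≤ i j≤k)) , (λ i → v∈xs _) ,
    λ i i′ p → Fin.inject≤-injective j≤k j≤k i i′ (v-antichain _ _ p)

  -- For a preorder, maximality means that whatever lies above `m` also lies below it.
  maximal : ∀ x xs → ∃[ m ] (m ∈ˡ x ∷ xs × (∀ {y} → y ∈ˡ x ∷ xs → m ≤ y → y ≤ m))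
  maximal x [] = x , here refl , λ { (here refl) p → p }
  maximal x (y ∷ ys) with maximal y ys
  ... | m , m∈ , m-max with m ≤? x
  ...   | yes m≤x = x , here refl , λ where
            (here refl) p → p
            (there z∈)  p → ≤-trans (m-max z∈ (≤-trans m≤x p)) m≤x
  ...   | no  m≰x = m , there m∈ , λ where
            (here refl) p → contradiction p m≰x
            (there z∈)  p → m-max z∈ p

  greatest : ∀ {k} (v : Fin (suc k) → A) → (∀ i j → v i ≤ v j ⊎ v j ≤ v i) →
             ∃[ j ] ∀ i → v i ≤ v j
  greatest {zero}  v total = zero , λ { zero → ≤-refl }
  greatest {suc k} v total with greatest (v ∘ suc) (λ i j → total (suc i) (suc j))
  ... | m , m-max with total zero (suc m)
  ...   | inj₁ p = suc m , λ { zero → p ; (suc i) → m-max i }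
  ...   | inj₂ p = zero , λ { zero → ≤-refl ; (suc i) → ≤-trans (m-max i) p }

  -- Two members of an antichain never share a chain, so `k` members use all `k` colours.
  transversal : ∀ {k xs} (C : ChainCover k xs) ((v , _) : Antichain k xs) →
                ∀ i → ∃[ j ] proj₁ C (v j) ≡ toℕ i
  transversal (χ , χ<k , χ-chain) (v , v∈xs , v-antichain) i =
    let j , eq = injective⇒surjective (λ j → fromℕ< (χ<k (v∈xs j))) colour-injective i
    in j , trans (sym (Fin.toℕ-fromℕ< _)) (cong toℕ eq)
    where
    colour-injective : Injective _≡_ _≡_ (λ j → fromℕ< (χ<k (v∈xs j)))
    colour-injective {j} {l} eq
      with χ-chain (v∈xs j) (v∈xs l) (Fin.fromℕ<-injective _ _ (χ<k (v∈xs j)) (χ<k (v∈xs l)) eq)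
    ... | inj₁ p = v-antichain j l p
    ... | inj₂ p = sym (v-antichain l j p)

  module _ (xs : List A) (m : A) (m∈xs : m ∈ˡ xs)
           (m-max : ∀ {y} → y ∈ˡ xs → m ≤ y → y ≤ m) where

    below? : Unary.Decidable (λ z → ¬ m ≤ z)
    below? z = ¬? (m ≤? z)

    -- As `m` is maximal, the entries dropped are exactly those equivalent to `m`.
    below : List A
    below = filter below? xs

    below-< : length below ℕ.< length xs
    below-< = List.filter-notAll below? xs (lose m∈xs (λ m≰m → m≰m ≤-refl))

    module _ {k : ℕ} (C : ChainCover (suc k) below) where
      χ = proj₁ C

      -- With `m` adjoined, this part of chain `i` is the chain that `cover-∷` splits off.
      K : Fin (suc k) → A → Set ℓ
      K i z = χ z ≡ toℕ i × z ≤ m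

      K? : ∀ i → Unary.Decidable (K i)
      K? i z = (χ z ℕ.≟ toℕ i) ×-dec (z ≤? m)

      remaining : Fin (suc k) → List A
      remaining i = filter (λ z → ¬? (K? i z)) below

      remaining-⊆ : ∀ i {x} → x ∈ˡ remaining i → x ∈ˡ below
      remaining-⊆ i = proj₁ ∘ ∈-filter⁻ (λ z → ¬? (K? i z))

      remaining-< : ∀ i → length (remaining i) ℕ.< length xs
      remaining-< i =
        ℕ.≤-<-trans (List.length-filter (λ z → ¬? (K? i z)) below) below-<

      -- The maxima, chain by chain, of the given antichains, together with m.
      bigger-antichain : (∀ i → Antichain (suc k) (remaining i)) →
                         Antichain (suc (suc k)) xs
      bigger-antichain anti = antichain-∷ m top m∈xs
        (λ i → proj₁ (∈-filter⁻ below? (top∈ i)))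
        (λ i → proj₂ (∈-filter⁻ below? {xs = xs} (top∈ i)))
        top≰m top-antichain
        where
        u : Fin (suc k) → Fin (suc k) → A
        u l = proj₁ (anti l)
        anti′ : ∀ l → Antichain (suc k) below
        anti′ l = antichain-⊆ (remaining-⊆ l) (anti l)
        t : ∀ l i → ∃[ j ] χ (u l j) ≡ toℕ i
        t l = transversal C (anti′ l)
        -- `e i l` is the member on chain `i` of the antichain that avoids `K l`; `top i` will be
        -- the greatest of these over all `l`.
        e : Fin (suc k) → Fin (suc k) → A
        e i l = u l (proj₁ (t l i))
        e∈ : ∀ i l → e i l ∈ˡ below
        e∈ i l = proj₁ (proj₂ (anti′ l)) (proj₁ (t l i))
        colour : ∀ i l → χ (e i l) ≡ toℕ i
        colour i l = proj₂ (t l i)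
        best : ∀ i → ∃[ l ] ∀ l′ → e i l′ ≤ e i l
        best i = greatest (e i) λ l l′ →
          proj₂ (proj₂ C) (e∈ i l) (e∈ i l′) (trans (colour i l) (sym (colour i l′)))
        top : Fin (suc k) → A
        top i = e i (proj₁ (best i))
        top∈ : ∀ i → top i ∈ˡ below
        top∈ i = e∈ i _
        top≰m : ∀ i → ¬ top i ≤ m
        -- `e i i` comes from the antichain avoiding `K i`, so it is not below `m`, and `top i` lies
        -- above it.
        top≰m i p = proj₂ (∈-filter⁻ (λ z → ¬? (K? i z)) {xs = below} (proj₁ (proj₂ (anti i)) _))
          (colour i i , ≤-trans (proj₂ (best i) i) p)
        top-antichain : ∀ i j → top i ≤ top j → i ≡ j
        top-antichain i j p = Fin.toℕ-injective
          (trans (sym (colour i l)) (trans (cong (χ ∘ u l) same) (colour j l)))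
          where
          -- The antichain `anti l` supplies `top j`. Its member on chain `i` is below `top i`,
          -- hence below `top j`, so the two members coincide.
          l = proj₁ (best j)
          same : proj₁ (t l i) ≡ proj₁ (t l j)
          same = proj₂ (proj₂ (anti l)) _ _ (≤-trans (proj₂ (best i) l) p)

      -- Colour 0 goes to `m`, its equivalents and `K i`; the colours of the remaining entries are
      -- shifted by one.
      cover-∷ : ∀ i → ChainCover k (remaining i) → ChainCover (suc k) xs
      cover-∷ i (ψ , ψ<k , ψ-chain) = φ , φ<k , φ-chain
        where
        first : A → Set ℓ
        first z = m ≤ z ⊎ K i z
        first? : Unary.Decidable first
        first? z with m ≤? z | K? i z
        ... | yes p | _     = yes (inj₁ p)
        ... | no ¬p | yes q = yes (inj₂ q)
        ... | no ¬p | no ¬q = no λ { (inj₁ p) → ¬p p ; (inj₂ q) → ¬q q }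
        rest : ∀ {z} → z ∈ˡ xs → ¬ first z → z ∈ˡ remaining i
        rest z∈ ¬f = ∈-filter⁺ (λ z → ¬? (K? i z))
          (∈-filter⁺ below? z∈ (¬f ∘ inj₁)) (¬f ∘ inj₂)
        φ : A → ℕ
        φ z with first? z
        ... | yes _ = 0
        ... | no  _ = suc (ψ z)
        φ<k : ∀ {z} → z ∈ˡ xs → φ z ℕ.< suc k
        φ<k {z} z∈ with first? z
        ... | yes _ = s≤s z≤n
        ... | no ¬f = s≤s (ψ<k (rest z∈ ¬f))
        first-chain : ∀ {x y} → x ∈ˡ xs → y ∈ˡ xs → first x → first y → x ≤ y ⊎ y ≤ x
        first-chain x∈ y∈ (inj₁ p) (inj₁ q) = inj₁ (≤-trans (m-max x∈ p) q)
        first-chain x∈ y∈ (inj₁ p) (inj₂ q) = inj₂ (≤-trans (proj₂ q) p)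
        first-chain x∈ y∈ (inj₂ p) (inj₁ q) = inj₁ (≤-trans (proj₂ p) q)
        -- `χ` gives chains only on `below`. An entry outside `below` is above `m` and so above the
        -- other entry, which is below `m`.
        first-chain {x} {y} x∈ y∈ (inj₂ p) (inj₂ q) with m ≤? x | m ≤? y
        ... | yes m≤x | _       = inj₂ (≤-trans (proj₂ q) m≤x)
        ... | no  _   | yes m≤y = inj₁ (≤-trans (proj₂ p) m≤y)
        ... | no  m≰x | no  m≰y = proj₂ (proj₂ C) (∈-filter⁺ below? x∈ m≰x)
          (∈-filter⁺ below? y∈ m≰y) (trans (proj₁ p) (sym (proj₁ q)))
        φ-chain : ∀ {x y} → x ∈ˡ xs → y ∈ˡ xs → φ x ≡ φ y → x ≤ y ⊎ y ≤ x
        φ-chain {x} {y} x∈ y∈ eq with first? x | first? y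
        ... | yes f | yes g = first-chain x∈ y∈ f g
        ... | no ¬f | no ¬g = ψ-chain (rest x∈ ¬f) (rest y∈ ¬g) (ℕ.suc-injective eq)

  -- After Galvin: for a maximal element m, some chain of a cover of the rest
  -- meets every (k + 1)-antichain below m, and that part of it together with
  -- m is a chain that can be split off.
  dilworth : ∀ k xs → Acc ℕ._<_ (length xs) → ¬ Antichain (suc k) xs → ChainCover k xs
  dilworth k [] _ _ = (λ _ → 0) , (λ ()) , λ ()
  dilworth zero (x ∷ xs) _ ¬anti = contradiction
    ((λ _ → x) , (λ _ → here refl) , λ { zero zero _ → refl }) ¬anti
  dilworth (suc k) xs@(y ∷ ys) (acc rec) ¬anti with maximal y ys
  ... | m , m∈xs , m-max
    with dilworth (suc k) (below xs m m∈xs m-max) (rec (below-< xs m m∈xs m-max))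
           (¬anti ∘ antichain-⊆ (proj₁ ∘ ∈-filter⁻ (below? xs m m∈xs m-max)))
  ...   | C with Fin.any? (λ i → ¬? (antichain? (suc k) (remaining xs m m∈xs m-max C i)))
  ...     | yes (i , ¬antiᵢ) = cover-∷ xs m m∈xs m-max C i
              (dilworth k _ (rec (remaining-< xs m m∈xs m-max C i)) ¬antiᵢ)
  ...     | no ¬∃ = contradiction
              (bigger-antichain xs m m∈xs m-max C λ i →
                decidable-stable (antichain? (suc k) _) λ ¬a → ¬∃ (i , ¬a))
              ¬anti

  dilworth-width : ∀ xs → ∃[ d ] (Antichain d xs × ¬ Antichain (suc d) xs × ChainCover d xs)
  dilworth-width xs
    with last-true (λ k → antichain? k xs) ((λ ()) , (λ ()) , λ ()) (suc (length xs))
           (λ anti → ℕ.1+n≰n (antichain-bound anti))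
  ... | d , anti , ¬anti = d , anti , ¬anti , dilworth d xs (<-wellFounded _) ¬anti

-- Sign patterns of rational hyperplanes

∑-mono-≤ : ∀ {n} (f g : Fin n → ℚ) → (∀ i → f i ℚ.≤ g i) → ∑.sum f ℚ.≤ ∑.sum g
∑-mono-≤ {zero}  f g f≤g = ℚ.≤-refl
∑-mono-≤ {suc n} f g f≤g =
  ℚ.+-mono-≤ (f≤g zero) (∑-mono-≤ (λ i → f (suc i)) (λ i → g (suc i)) (λ i → f≤g (suc i)))

∑-mono-< : ∀ {n} (f g : Fin n → ℚ) → (∀ i → f i ℚ.≤ g i) →
           ∀ p → f p ℚ.< g p → ∑.sum f ℚ.< ∑.sum g
∑-mono-< f g f≤g zero fp<gp =
  ℚ.+-mono-<-≤ fp<gp (∑-mono-≤ (λ i → f (suc i)) (λ i → g (suc i)) (λ i → f≤g (suc i)))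
∑-mono-< f g f≤g (suc p) fp<gp =
  ℚ.+-mono-≤-< (f≤g zero) (∑-mono-< (λ i → f (suc i)) (λ i → g (suc i)) (λ i → f≤g (suc i)) p fp<gp)

infix 7 _∙_
_∙_ : ∀ {n} → (Fin n → ℚ) → (Fin n → ℚ) → ℚ
a ∙ x = ∑.sum (λ i → a i ℚ.* x i)

∙-linearˡ : ∀ {n} s (a : Fin n → ℚ) t b x →
            (λ i → s ℚ.* a i ℚ.+ t ℚ.* b i) ∙ x ≡ s ℚ.* (a ∙ x) ℚ.+ t ℚ.* (b ∙ x)
∙-linearˡ s a t b x = begin
  ∑.sum (λ i → (s ℚ.* a i ℚ.+ t ℚ.* b i) ℚ.* x i)
    ≡⟨ ∑.sum-cong-≗ (λ i → regroup s (a i) t (b i) (x i)) ⟩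
  ∑.sum (λ i → s ℚ.* (a i ℚ.* x i) ℚ.+ t ℚ.* (b i ℚ.* x i))
    ≡⟨ ∑.∑-distrib-+ (λ i → s ℚ.* (a i ℚ.* x i)) (λ i → t ℚ.* (b i ℚ.* x i)) ⟩
  ∑.sum (λ i → s ℚ.* (a i ℚ.* x i)) ℚ.+ ∑.sum (λ i → t ℚ.* (b i ℚ.* x i))
    ≡⟨ cong₂ ℚ._+_ (∑.*-distribˡ-sum s (λ i → a i ℚ.* x i))
                   (∑.*-distribˡ-sum t (λ i → b i ℚ.* x i)) ⟨
  s ℚ.* (a ∙ x) ℚ.+ t ℚ.* (b ∙ x) ∎
  where
  open ≡-Reasoning
  regroup : ∀ s a t b x →
    (s ℚ.* a ℚ.+ t ℚ.* b) ℚ.* x ≡ s ℚ.* (a ℚ.* x) ℚ.+ t ℚ.* (b ℚ.* x)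
  regroup = solve 5 (λ s a t b x →
    (s :* a :+ t :* b) :* x := s :* (a :* x) :+ t :* (b :* x)) refl
    where open +-*-Solver

-- The case of `c (A x) = (c A) x` in which `c A` is zero, by exchanging the two sums.
∙-assoc : ∀ {m n} (c : Fin m → ℚ) (A : Fin m → Fin n → ℚ) x →
          (∀ j → c ∙ (λ i → A i j) ≡ 0ℚ) → c ∙ (λ i → A i ∙ x) ≡ 0ℚ
∙-assoc {m} {n} c A x cA≡0 = begin
  ∑.sum (λ i → c i ℚ.* ∑.sum (λ j → A i j ℚ.* x j))
    ≡⟨ ∑.sum-cong-≗ (λ i → ∑.*-distribˡ-sum (c i) (λ j → A i j ℚ.* x j)) ⟩
  ∑.sum (λ i → ∑.sum (λ j → c i ℚ.* (A i j ℚ.* x j)))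
    ≡⟨ ∑.∑-comm (λ i j → c i ℚ.* (A i j ℚ.* x j)) ⟩
  ∑.sum (λ j → ∑.sum (λ i → c i ℚ.* (A i j ℚ.* x j)))
    ≡⟨ ∑.sum-cong-≗ (λ j → column j) ⟩
  ∑.sum {n} (λ _ → 0ℚ)
    ≡⟨ ∑.sum-replicate-zero n ⟩
  0ℚ ∎
  where
  open ≡-Reasoning
  column : ∀ j → ∑.sum (λ i → c i ℚ.* (A i j ℚ.* x j)) ≡ 0ℚ
  column j = begin
    ∑.sum (λ i → c i ℚ.* (A i j ℚ.* x j))
      ≡⟨ ∑.sum-cong-≗ (λ i → ℚ.*-assoc (c i) (A i j) (x j)) ⟨
    ∑.sum (λ i → (c i ℚ.* A i j) ℚ.* x j)
      ≡⟨ ∑.*-distribʳ-sum (x j) (λ i → c i ℚ.* A i j) ⟨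
    (c ∙ (λ i → A i j)) ℚ.* x j
      ≡⟨ cong (ℚ._* x j) (cA≡0 j) ⟩
    0ℚ ℚ.* x j
      ≡⟨ ℚ.*-zeroˡ (x j) ⟩
    0ℚ ∎

∙-insertAt-0 : ∀ {n} (c : Fin n → ℚ) p x →
               Vector.insertAt c p 0ℚ ∙ x ≡ c ∙ (λ i → x (punchIn p i))
∙-insertAt-0 c p x = begin
  Vector.insertAt c p 0ℚ ∙ x
    ≡⟨ ∑.sum-remove {i = p} (λ i → Vector.insertAt c p 0ℚ i ℚ.* x i) ⟩
  Vector.insertAt c p 0ℚ p ℚ.* x p ℚ.+
    ∑.sum (λ i → Vector.insertAt c p 0ℚ (punchIn p i) ℚ.* x (punchIn p i))
    ≡⟨ cong₂ ℚ._+_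
         (trans (cong (ℚ._* x p) (Vector.insertAt-lookup c p 0ℚ)) (ℚ.*-zeroˡ (x p)))
         (∑.sum-cong-≗ (λ i → cong (ℚ._* x (punchIn p i)) (Vector.insertAt-punchIn c p 0ℚ i))) ⟩
  0ℚ ℚ.+ c ∙ (λ i → x (punchIn p i))
    ≡⟨ ℚ.+-identityˡ _ ⟩
  c ∙ (λ i → x (punchIn p i)) ∎
  where open ≡-Reasoning

*-≢0 : ∀ {p q} → p ≢ 0ℚ → q ≢ 0ℚ → p ℚ.* q ≢ 0ℚ
*-≢0 {p} {q} p≢0 q≢0 pq≡0 = p≢0 (begin
  p                       ≡⟨ ℚ.*-identityʳ p ⟨
  p ℚ.* 1ℚ                ≡⟨ cong (p ℚ.*_) (ℚ.*-inverseʳ q) ⟨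
  p ℚ.* (q ℚ.* ℚ.1/ q)    ≡⟨ ℚ.*-assoc p q (ℚ.1/ q) ⟨
  (p ℚ.* q) ℚ.* ℚ.1/ q    ≡⟨ cong (ℚ._* ℚ.1/ q) pq≡0 ⟩
  0ℚ ℚ.* ℚ.1/ q           ≡⟨ ℚ.*-zeroˡ (ℚ.1/ q) ⟩
  0ℚ ∎)
  where
  open ≡-Reasoning
  instance
    q-nonZero : ℚ.NonZero q
    q-nonZero = ℚ.≢-nonZero q≢0

-- A nontrivial linear dependency among the rows of `A`, that is, a nonzero vector of its left
-- kernel.
Kernel : ∀ {m n} → (Fin n → Fin m → ℚ) → Set
Kernel {m} {n} A = Σ (Fin n → ℚ) λ c →
  (∃[ p ] c p ≢ 0ℚ) × (∀ j → c ∙ (λ i → A i j) ≡ 0ℚ)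

-- Two solutions of all but the first equation, the second of them
-- vanishing at a place where the first does not, have a nonzero
-- combination that also solves the first equation.
kernel : ∀ m n → m ℕ.≤ n → (A : Fin (suc n) → Fin m → ℚ) → Kernel A
kernel zero n _ A = (λ _ → 1ℚ) , (zero , λ ()) , λ ()
kernel (suc m) (suc n) (s≤s m≤n) A
  = combine (s₁ ℚ.≟ 0ℚ) (s₂ ℚ.≟ 0ℚ)
  where
  -- Row `p` and the first column are deleted, the rest is solved by induction, and the coefficient
  -- zero is put back at `p`.
  solution : ∀ p → Σ (Fin (suc (suc n)) → ℚ) λ c → c p ≡ 0ℚ ×
    (∃[ q ] c q ≢ 0ℚ) × (∀ j → c ∙ (λ i → A i (suc j)) ≡ 0ℚ)
  solution p with kernel m n m≤n (λ i j → A (punchIn p i) (suc j))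
  ... | c , (q , cq≢0) , cA≡0 = Vector.insertAt c p 0ℚ , Vector.insertAt-lookup c p 0ℚ ,
    (punchIn p q , subst (_≢ 0ℚ) (sym (Vector.insertAt-punchIn c p 0ℚ q)) cq≢0) ,
    λ j → trans (∙-insertAt-0 c p (λ i → A i (suc j))) (cA≡0 j)
  first = solution zero
  c₁ = proj₁ first
  p = proj₁ (proj₁ (proj₂ (proj₂ first)))
  c₁p≢0 = proj₂ (proj₁ (proj₂ (proj₂ first)))
  c₁A≡0 = proj₂ (proj₂ (proj₂ first))
  second = solution p
  c₂ = proj₁ second
  c₂A≡0 = proj₂ (proj₂ (proj₂ second))
  s₁ s₂ : ℚ
  s₁ = c₁ ∙ (λ i → A i zero)
  s₂ = c₂ ∙ (λ i → A i zero)
  combine : Dec (s₁ ≡ 0ℚ) → Dec (s₂ ≡ 0ℚ) → Kernel A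
  combine (yes s₁≡0) _ = c₁ , (p , c₁p≢0) , λ { zero → s₁≡0 ; (suc j) → c₁A≡0 j }
  combine _ (yes s₂≡0) = c₂ , proj₁ (proj₂ (proj₂ second)) ,
    λ { zero → s₂≡0 ; (suc j) → c₂A≡0 j }
  combine (no s₁≢0) (no s₂≢0) = c , (p , cp≢0) , cA≡0
    where
    c : Fin (suc (suc n)) → ℚ
    -- The crosswise weights cancel the first column; at `p` only the `c₁` term survives.
    c i = s₂ ℚ.* c₁ i ℚ.+ (ℚ.- s₁) ℚ.* c₂ i
    cp≡ : c p ≡ s₂ ℚ.* c₁ p
    cp≡ = begin
      s₂ ℚ.* c₁ p ℚ.+ (ℚ.- s₁) ℚ.* c₂ p
        ≡⟨ cong (λ q → s₂ ℚ.* c₁ p ℚ.+ (ℚ.- s₁) ℚ.* q) (proj₁ (proj₂ second)) ⟩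
      s₂ ℚ.* c₁ p ℚ.+ (ℚ.- s₁) ℚ.* 0ℚ
        ≡⟨ cong (s₂ ℚ.* c₁ p ℚ.+_) (ℚ.*-zeroʳ (ℚ.- s₁)) ⟩
      s₂ ℚ.* c₁ p ℚ.+ 0ℚ
        ≡⟨ ℚ.+-identityʳ _ ⟩
      s₂ ℚ.* c₁ p ∎
      where open ≡-Reasoning
    cp≢0 : c p ≢ 0ℚ
    cp≢0 = subst (_≢ 0ℚ) (sym cp≡) (*-≢0 s₂≢0 c₁p≢0)
    cancel : ∀ s t → t ℚ.* s ℚ.+ (ℚ.- s) ℚ.* t ≡ 0ℚ
    cancel = solve 2 (λ s t → t :* s :+ (:- s) :* t := con 0ℚ) refl
      where open +-*-Solver
    cA≡0 : ∀ j → c ∙ (λ i → A i j) ≡ 0ℚ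
    cA≡0 zero    = trans (∙-linearˡ s₂ c₁ (ℚ.- s₁) c₂ (λ i → A i zero)) (cancel s₁ s₂)
    cA≡0 (suc j) = begin
      c ∙ (λ i → A i (suc j))
        ≡⟨ ∙-linearˡ s₂ c₁ (ℚ.- s₁) c₂ (λ i → A i (suc j)) ⟩
      s₂ ℚ.* (c₁ ∙ (λ i → A i (suc j))) ℚ.+ (ℚ.- s₁) ℚ.* (c₂ ∙ (λ i → A i (suc j)))
        ≡⟨ cong₂ (λ q r → s₂ ℚ.* q ℚ.+ (ℚ.- s₁) ℚ.* r) (c₁A≡0 j) (c₂A≡0 j) ⟩
      s₂ ℚ.* 0ℚ ℚ.+ (ℚ.- s₁) ℚ.* 0ℚ
        ≡⟨ cong₂ ℚ._+_ (ℚ.*-zeroʳ s₂) (ℚ.*-zeroʳ (ℚ.- s₁)) ⟩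
      0ℚ ∎
      where open ≡-Reasoning

-- A point on the side of each hyperplane prescribed by the signs of c
-- makes c ∙ b negative; both c and -c have such a point.
separated⇒≤ : ∀ {k m} (A : Fin k → Fin m → ℚ) (b : Fin k → ℚ) (x : Vec Bool k → Fin m → ℚ) →
  (∀ s i → Vec.lookup s i ≡ true  → b i ℚ.< A i ∙ x s) →
  (∀ s i → Vec.lookup s i ≡ false → A i ∙ x s ℚ.< b i) →
  k ℕ.≤ m
separated⇒≤ {zero} A b x above below = z≤n
separated⇒≤ {suc k} {m} A b x above below with m ℕ.≤? k
... | no  m≰k = ℕ.≰⇒> m≰k
... | yes m≤k with kernel m k m≤k A
...   | c , (p , cp≢0) , cA≡0 = contradiction
          (ℚ.+-mono-< (negative c p cp≢0 cA≡0) (negative -c p -cp≢0 -cA≡0))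
          (λ lt → ℚ.<-irrefl (cancel (c ∙ b)) (subst (λ q → c ∙ b ℚ.+ q ℚ.< 0ℚ) (-c∙ b) lt))
  where
  -c : Fin (suc k) → ℚ
  -c i = (ℚ.- 1ℚ) ℚ.* c i
  -c∙ : ∀ y → -c ∙ y ≡ (ℚ.- 1ℚ) ℚ.* (c ∙ y)
  -c∙ y = trans (∑.sum-cong-≗ (λ i → ℚ.*-assoc (ℚ.- 1ℚ) (c i) (y i)))
                (sym (∑.*-distribˡ-sum (ℚ.- 1ℚ) (λ i → c i ℚ.* y i)))
  -cp≢0 : -c p ≢ 0ℚ
  -cp≢0 = *-≢0 {ℚ.- 1ℚ} (λ ()) cp≢0
  -cA≡0 : ∀ j → -c ∙ (λ i → A i j) ≡ 0ℚ
  -cA≡0 j = trans (-c∙ (λ i → A i j)) (trans (cong ((ℚ.- 1ℚ) ℚ.*_) (cA≡0 j)) (ℚ.*-zeroʳ (ℚ.- 1ℚ)))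
  cancel : ∀ q → q ℚ.+ (ℚ.- 1ℚ) ℚ.* q ≡ 0ℚ
  cancel = solve 1 (λ q → q :+ con (ℚ.- 1ℚ) :* q := con 0ℚ) refl
    where open +-*-Solver
  negative : ∀ c p → c p ≢ 0ℚ → (∀ j → c ∙ (λ i → A i j) ≡ 0ℚ) → c ∙ b ℚ.< 0ℚ
  -- `c ∙ (A x)` is zero for every `x`, so it is enough to compare termwise, strictly at `p`.
  negative c p cp≢0 cA≡0 = subst (c ∙ b ℚ.<_) (∙-assoc c A (x s) cA≡0)
    (∑-mono-< (λ i → c i ℚ.* b i) (λ i → c i ℚ.* (A i ∙ x s)) weak p (strict p cp≢0))
    where
    -- A zero coefficient gets `false`, which is harmless: its two terms are both zero.
    side : Fin (suc k) → Bool
    side i = does (0ℚ ℚ.<? c i)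
    s : Vec Bool (suc k)
    s = Vec.tabulate side
    strict : ∀ i → c i ≢ 0ℚ → c i ℚ.* b i ℚ.< c i ℚ.* (A i ∙ x s)
    strict i ci≢0 with 0ℚ ℚ.<? c i in eq
    ... | yes 0<ci = ℚ.*-monoʳ-<-pos (c i) {{ℚ.positive 0<ci}}
            (above s i (trans (Vec.lookup∘tabulate side i) (cong does eq)))
    ... | no  0≮ci = ℚ.*-monoʳ-<-neg (c i) {{ℚ.negative ci<0}}
            (below s i (trans (Vec.lookup∘tabulate side i) (cong does eq)))
      where
      ci<0 : c i ℚ.< 0ℚ
      ci<0 with ℚ.<-cmp (c i) 0ℚ
      ... | tri< lt _ _ = lt
      ... | tri≈ _ e _ = contradiction e ci≢0
      ... | tri> _ _ gt = contradiction gt 0≮ci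
    weak : ∀ i → c i ℚ.* b i ℚ.≤ c i ℚ.* (A i ∙ x s)
    weak i with c i ℚ.≟ 0ℚ
    ... | no  ci≢0 = ℚ.<⇒≤ (strict i ci≢0)
    ... | yes ci≡0 = ℚ.≤-reflexive (trans (vanish (b i)) (sym (vanish (A i ∙ x s))))
      where
      vanish : ∀ q → c i ℚ.* q ≡ 0ℚ
      vanish q = trans (cong (ℚ._* q) ci≡0) (ℚ.*-zeroˡ q)

-- Real points and hyperplanes

Eventually : (ℕ → Set ℓᵖ) → Set ℓᵖ
Eventually P = ∃[ N ] (∀ n → N ℕ.≤ n → P n)

eventually-map : ∀ {p q} {P : ℕ → Set p} {Q : ℕ → Set q} →
                 (∀ n → P n → Q n) → Eventually P → Eventually Q
eventually-map f (N , Pn) = N , λ n N≤n → f n (Pn n N≤n)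

eventually-× : ∀ {p q} {P : ℕ → Set p} {Q : ℕ → Set q} →
               Eventually P → Eventually Q → Eventually (λ n → P n × Q n)
eventually-× (M , Pn) (N , Qn) = M ℕ.⊔ N , λ n ≤n →
  Pn n (ℕ.m⊔n≤o⇒m≤o M N ≤n) , Qn n (ℕ.m⊔n≤o⇒n≤o M N ≤n)

eventually-∀Fin : ∀ {k} {P : Fin k → ℕ → Set ℓᵖ} →
                  (∀ i → Eventually (P i)) → Eventually (λ n → ∀ i → P i n)
eventually-∀Fin {k = zero}  ev = 0 , λ _ _ ()
eventually-∀Fin {k = suc k} ev = eventually-map
  (λ { n (P₀ , Ps) zero → P₀ ; n (P₀ , Ps) (suc i) → Ps i })
  (eventually-× (ev zero) (eventually-∀Fin (ev ∘ suc)))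

-- Recursion on the length finds one index that serves all sign vectors, of which there are finitely
-- many.
eventually-∀Vec : ∀ {k} {P : Vec Bool k → ℕ → Set ℓᵖ} →
                  (∀ s → Eventually (P s)) → Eventually (λ n → ∀ s → P s n)
eventually-∀Vec {k = zero}  ev = eventually-map (λ { n Pn Vec.[] → Pn }) (ev Vec.[])
eventually-∀Vec {k = suc k} ev = eventually-map
  (λ { n (Pt , Pf) (true Vec.∷ s) → Pt s ; n (Pt , Pf) (false Vec.∷ s) → Pf s })
  (eventually-× (eventually-∀Vec (λ s → ev (true Vec.∷ s)))
                (eventually-∀Vec (λ s → ev (false Vec.∷ s))))

infixl 8 _at_
_at_ : ∀ {m} → ℝ^ m → ℕ → Fin m → ℚ
(x at n) i = seq (x i) n

seq-sum : ∀ {k} (v : Fin k → ℝ) n → seq (sum v) n ≡ ∑.sum (v at n)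
seq-sum {zero}  v n = refl
seq-sum {suc k} v n = cong (seq (v zero) n ℚ.+_) (seq-sum (v ∘ suc) n)

seq-· : ∀ {m} (a x : ℝ^ m) n → seq (a · x) n ≡ (a at n) ∙ (x at n)
seq-· a x = seq-sum (λ i → a i *ᴿ x i)

half-pos : ∀ {ε} → 0ℚ ℚ.< ε → 0ℚ ℚ.< ½ ℚ.* ε
half-pos {ε} ε>0 = ℚ.positive⁻¹ (½ ℚ.* ε)
  {{ℚ.pos*pos⇒pos ½ ε {{ℚ.positive ε>0}}}}

half+half : ∀ ε → ½ ℚ.* ε ℚ.+ ½ ℚ.* ε ≡ ε
half+half = solve 1 (λ ε → con ½ :* ε :+ con ½ :* ε := ε) refl
  where open +-*-Solver

p<p+q : ∀ p {q} → 0ℚ ℚ.< q → p ℚ.< p ℚ.+ q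
p<p+q p {q} 0<q = subst (ℚ._< p ℚ.+ q) (ℚ.+-identityʳ p) (ℚ.+-monoʳ-< p 0<q)

p-q+q≡p : ∀ p q → (p ℚ.- q) ℚ.+ q ≡ p
p-q+q≡p = solve 2 (λ p q → (p :- q) :+ q := p) refl
  where open +-*-Solver

p-q<r⇒p<r+q : ∀ p q {r} → p ℚ.- q ℚ.< r → p ℚ.< r ℚ.+ q
p-q<r⇒p<r+q p q {r} lt = subst (ℚ._< r ℚ.+ q) (p-q+q≡p p q) (ℚ.+-monoˡ-< q lt)

r<p-q⇒r+q<p : ∀ p q {r} → r ℚ.< p ℚ.- q → r ℚ.+ q ℚ.< p
r<p-q⇒r+q<p p q {r} lt = subst (r ℚ.+ q ℚ.<_) (p-q+q≡p p q) (ℚ.+-monoˡ-< q lt)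

p≤∣p∣ : ∀ p → p ℚ.≤ ∣ p ∣
p≤∣p∣ p with ℚ.∣p∣≡p∨∣p∣≡-p p
... | inj₁ eq = ℚ.≤-reflexive (sym eq)
... | inj₂ eq with ℚ.≤-total 0ℚ p
...   | inj₁ 0≤p = ℚ.≤-reflexive (sym (ℚ.0≤p⇒∣p∣≡p 0≤p))
...   | inj₂ p≤0 = ℚ.≤-trans p≤0 (ℚ.0≤∣p∣ p)

<ᴿ⇒eventually : ∀ {x y} → x <ᴿ y → Eventually (λ n → seq x n ℚ.< seq y n)
<ᴿ⇒eventually (ε , ε>0 , ev) =
  eventually-map (λ n lt → ℚ.<-trans (p<p+q _ ε>0) lt) ev

-- `_<ᴿ_` asks for a gap that leaves the inequality strict, so the gap runs from `p` only to a
-- rational strictly between `p` and `q`.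
const-<ᴿ : ∀ {x y p q} → (∀ n → seq x n ≡ p) → (∀ n → seq y n ≡ q) → p ℚ.< q → x <ᴿ y
const-<ᴿ {x} {y} {p} {q} x≡p y≡q p<q with ℚ.<-dense p<q
... | r , p<r , r<q = r ℚ.- p , 0<r-p , 0 , λ n _ →
  subst₂ ℚ._<_ (trans (sym (p+[r-p]≡r p r)) (cong (ℚ._+ (r ℚ.- p)) (sym (x≡p n)))) (sym (y≡q n)) r<q
  where
  p+[r-p]≡r : ∀ p r → p ℚ.+ (r ℚ.- p) ≡ r
  p+[r-p]≡r = solve 2 (λ p r → p :+ (r :- p) := r) refl
    where open +-*-Solver
  0<r-p : 0ℚ ℚ.< r ℚ.- p
  0<r-p = subst (ℚ._< r ℚ.- p) (ℚ.+-inverseʳ p) (ℚ.+-monoˡ-< (ℚ.- p) p<r)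

-- Beyond `N` the difference `z` varies by less than half of `η`. If it reached `η` once, it would
-- exceed half of `η` throughout, which gives `y <ᴿ x` with a quarter of `η` as gap.
≤ᴿ⇒eventually : ∀ x y {η} → x ≤ᴿ y → 0ℚ ℚ.< η →
                Eventually (λ n → seq x n ℚ.< η ℚ.+ seq y n)
≤ᴿ⇒eventually x y {η} x≤y η>0 with isCauchy (x -ᴿ y) (½ ℚ.* η) (half-pos η>0)
... | N , close = eventually-map (λ n → p-q<r⇒p<r+q (seq x n) (seq y n)) (N , bound)
  where
  z : ℕ → ℚ
  z n = seq x n ℚ.- seq y n
  z<½η+z : ∀ m n → N ℕ.≤ m → N ℕ.≤ n → z m ℚ.< ½ ℚ.* η ℚ.+ z n
  z<½η+z m n N≤m N≤n = p-q<r⇒p<r+q (z m) (z n)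
    (ℚ.≤-<-trans (p≤∣p∣ (z m ℚ.- z n)) (close m n N≤m N≤n))
  bound : ∀ n → N ℕ.≤ n → z n ℚ.< η
  bound n N≤n with ℚ._<?_ (z n) η
  ... | yes lt = lt
  ... | no ≮η = contradiction (½ ℚ.* (½ ℚ.* η) , half-pos (half-pos η>0) , N , far) x≤y
    where
    ½η<z : ∀ k → N ℕ.≤ k → ½ ℚ.* η ℚ.< z k
    ½η<z k N≤k = ℚ.≰⇒> λ z≤½η → ≮η (ℚ.<-≤-trans (z<½η+z n k N≤n N≤k)
      (subst (½ ℚ.* η ℚ.+ z k ℚ.≤_) (half+half η) (ℚ.+-monoʳ-≤ (½ ℚ.* η) z≤½η)))
    far : ∀ k → N ℕ.≤ k → seq y k ℚ.+ ½ ℚ.* (½ ℚ.* η) ℚ.< seq x k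
    far k N≤k = ℚ.<-trans
      (ℚ.+-monoʳ-< (seq y k) (subst (½ ℚ.* (½ ℚ.* η) ℚ.<_) (half+half (½ ℚ.* η))
        (p<p+q _ (half-pos (half-pos η>0)))))
      (subst (ℚ._< seq x k) (ℚ.+-comm (½ ℚ.* η) (seq y k))
        (r<p-q⇒r+q<p (seq x k) (seq y k) (½η<z k N≤k)))

-- A quantitative positive orthant: carrying an upper bound makes
-- convexity provable without comparing reals.
Orthant : ∀ {m} → Pred (ℝ^ m) _
Orthant x = ∃[ δ ] ∃[ B ] (0ℚ ℚ.< δ ×
  Eventually (λ n → ∀ i → δ ℚ.< (x at n) i × (x at n) i ℚ.< B))

-- Serves both invariance under `_≈ᵛ_` and openness: a shift by less than half of `δ` keeps half of
-- the margin.
orthant-near : ∀ {m} (x y : ℝ^ m) (δ B : ℚ) → 0ℚ ℚ.< δ →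
  Eventually (λ n → ∀ i → δ ℚ.< (x at n) i × (x at n) i ℚ.< B) →
  (∀ i → Eventually (λ n → ℚ.- (½ ℚ.* δ) ℚ.< (y at n) i ℚ.- (x at n) i
                         × (y at n) i ℚ.- (x at n) i ℚ.< ½ ℚ.* δ)) →
  Orthant y
orthant-near x y δ B δ>0 x∈ near = ½ ℚ.* δ , ½ ℚ.* δ ℚ.+ B , half-pos δ>0 ,
  eventually-map (λ n (inside , close) i →
      lower ((x at n) i) ((y at n) i) (proj₁ (inside i)) (proj₁ (close i)) ,
      upper ((x at n) i) ((y at n) i) (proj₂ (inside i)) (proj₂ (close i)))
    (eventually-× x∈ (eventually-∀Fin near))
  where
  -½δ+δ : ∀ δ → ℚ.- (½ ℚ.* δ) ℚ.+ δ ≡ ½ ℚ.* δ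
  -½δ+δ = solve 1 (λ δ → :- (con ½ :* δ) :+ δ := con ½ :* δ) refl
    where open +-*-Solver
  lower : ∀ p q → δ ℚ.< p → ℚ.- (½ ℚ.* δ) ℚ.< q ℚ.- p → ½ ℚ.* δ ℚ.< q
  lower p q δ<p lt = ℚ.<-trans
    (subst (ℚ._< ℚ.- (½ ℚ.* δ) ℚ.+ p) (-½δ+δ δ) (ℚ.+-monoʳ-< (ℚ.- (½ ℚ.* δ)) δ<p))
    (r<p-q⇒r+q<p q p lt)
  upper : ∀ p q → p ℚ.< B → q ℚ.- p ℚ.< ½ ℚ.* δ → q ℚ.< ½ ℚ.* δ ℚ.+ B
  upper p q p<B lt =
    ℚ.<-trans (p-q<r⇒p<r+q q p lt) (ℚ.+-monoʳ-< (½ ℚ.* δ) p<B)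

∣p-q∣<r⇒-r<q-p<r : ∀ p q {r} → ∣ p ℚ.- q ∣ ℚ.< r →
                   ℚ.- r ℚ.< q ℚ.- p × q ℚ.- p ℚ.< r
∣p-q∣<r⇒-r<q-p<r p q {r} lt =
    subst (ℚ.- r ℚ.<_) neg-minus
      (ℚ.neg-antimono-< (ℚ.≤-<-trans (p≤∣p∣ (p ℚ.- q)) lt))
  , ℚ.≤-<-trans (p≤∣p∣ (q ℚ.- p)) (subst (ℚ._< r)
      (trans (sym (ℚ.∣-p∣≡∣p∣ (p ℚ.- q))) (cong ∣_∣ neg-minus)) lt)
  where
  neg-minus : ℚ.- (p ℚ.- q) ≡ q ℚ.- p
  neg-minus = solve 2 (λ p q → :- (p :- q) := q :- p) refl p q
    where open +-*-Solver

orthant-resp : ∀ {m} → Orthant {m} Respects _≈ᵛ_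
orthant-resp {x = x} {y = y} x≈y (δ , B , δ>0 , x∈) = orthant-near x y δ B δ>0 x∈ λ i →
  eventually-map (λ n → ∣p-q∣<r⇒-r<q-p<r ((x at n) i) ((y at n) i))
    (x≈y i (½ ℚ.* δ) (half-pos δ>0))

orthant-open : ∀ {m} → RelativelyOpen (Orthant {m})
orthant-open x (δ , B , δ>0 , x∈) =
  fromℚ (½ ℚ.* δ) , const-<ᴿ {0ᴿ} {fromℚ (½ ℚ.* δ)} (λ _ → refl) (λ _ → refl) (half-pos δ>0) ,
  λ y _ near → orthant-near x y δ B δ>0 x∈ λ i →
    eventually-× (<ᴿ⇒eventually { -ᴿ fromℚ (½ ℚ.* δ)} {y i -ᴿ x i} (proj₁ (near i)))
                 (<ᴿ⇒eventually {y i -ᴿ x i} {fromℚ (½ ℚ.* δ)} (proj₂ (near i)))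

-- Approximants of a `t` in the unit interval may leave it by up to `η`. The shifted weights `s` and
-- `r` are positive, and the correction `η x + η y` is below `2 η B`, half of `δ`.
module _ (δ η B x y t : ℚ) (δ>0 : 0ℚ ℚ.< δ) (η>0 : 0ℚ ℚ.< η) (ηB≡ : η ℚ.* B ≡ ½ ℚ.* (½ ℚ.* δ))
         (δ<x : δ ℚ.< x) (x<B : x ℚ.< B) (δ<y : δ ℚ.< y) (y<B : y ℚ.< B)
         (0<η+t : 0ℚ ℚ.< η ℚ.+ t) (t<η+1 : t ℚ.< η ℚ.+ 1ℚ) where

  private
    s r z : ℚ
    s = η ℚ.+ t
    r = (η ℚ.+ 1ℚ) ℚ.- t
    z = t ℚ.* x ℚ.+ (1ℚ ℚ.- t) ℚ.* y
    0<r : 0ℚ ℚ.< r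
    0<r = subst (ℚ._< r) (ℚ.+-inverseʳ t) (ℚ.+-monoˡ-< (ℚ.- t) t<η+1)
    instance
      s-pos : ℚ.Positive s
      s-pos = ℚ.positive 0<η+t
      r-pos : ℚ.Positive r
      r-pos = ℚ.positive 0<r
      η-pos : ℚ.Positive η
      η-pos = ℚ.positive η>0
    regroup : ∀ η t x y →
      ((η ℚ.+ t) ℚ.* x ℚ.+ ((η ℚ.+ 1ℚ) ℚ.- t) ℚ.* y) ℚ.- (η ℚ.* x ℚ.+ η ℚ.* y)
        ≡ t ℚ.* x ℚ.+ (1ℚ ℚ.- t) ℚ.* y
    regroup = solve 4 (λ η t x y →
      ((η :+ t) :* x :+ ((η :+ con 1ℚ) :- t) :* y) :- (η :* x :+ η :* y)
        := t :* x :+ (con 1ℚ :- t) :* y) refl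
      where open +-*-Solver

  interpolation-lower : ½ ℚ.* δ ℚ.< z
  interpolation-lower = begin-strict
    ½ ℚ.* δ
      <⟨ p<p+q (½ ℚ.* δ) (ℚ.+-mono-< 0<ηδ 0<ηδ) ⟩
    ½ ℚ.* δ ℚ.+ (η ℚ.* δ ℚ.+ η ℚ.* δ)
      ≡⟨ expand η t δ ⟨
    (s ℚ.* δ ℚ.+ r ℚ.* δ) ℚ.- (½ ℚ.* (½ ℚ.* δ) ℚ.+ ½ ℚ.* (½ ℚ.* δ))
      ≡⟨ cong (λ q → (s ℚ.* δ ℚ.+ r ℚ.* δ) ℚ.- (q ℚ.+ q)) ηB≡ ⟨
    (s ℚ.* δ ℚ.+ r ℚ.* δ) ℚ.- (η ℚ.* B ℚ.+ η ℚ.* B)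
      <⟨ ℚ.+-mono-<
           (ℚ.+-mono-< (ℚ.*-monoʳ-<-pos s δ<x) (ℚ.*-monoʳ-<-pos r δ<y))
           (ℚ.neg-antimono-< (ℚ.+-mono-< (ℚ.*-monoʳ-<-pos η x<B) (ℚ.*-monoʳ-<-pos η y<B))) ⟩
    (s ℚ.* x ℚ.+ r ℚ.* y) ℚ.- (η ℚ.* x ℚ.+ η ℚ.* y)
      ≡⟨ regroup η t x y ⟩
    z ∎
    where
    open ℚ.≤-Reasoning
    0<ηδ : 0ℚ ℚ.< η ℚ.* δ
    0<ηδ = ℚ.positive⁻¹ (η ℚ.* δ) {{ℚ.pos*pos⇒pos η δ {{ℚ.positive δ>0}}}}
    expand : ∀ η t δ →
      ((η ℚ.+ t) ℚ.* δ ℚ.+ ((η ℚ.+ 1ℚ) ℚ.- t) ℚ.* δ) ℚ.- (½ ℚ.* (½ ℚ.* δ) ℚ.+ ½ ℚ.* (½ ℚ.* δ))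
        ≡ ½ ℚ.* δ ℚ.+ (η ℚ.* δ ℚ.+ η ℚ.* δ)
    expand = solve 3 (λ η t δ →
      ((η :+ t) :* δ :+ ((η :+ con 1ℚ) :- t) :* δ) :-
        (con ½ :* (con ½ :* δ) :+ con ½ :* (con ½ :* δ))
        := con ½ :* δ :+ (η :* δ :+ η :* δ)) refl
      where open +-*-Solver

  interpolation-upper : z ℚ.< B ℚ.+ ½ ℚ.* δ
  interpolation-upper = begin-strict
    z
      ≡⟨ regroup η t x y ⟨
    (s ℚ.* x ℚ.+ r ℚ.* y) ℚ.- (η ℚ.* x ℚ.+ η ℚ.* y)
      <⟨ ℚ.+-mono-<
           (ℚ.+-mono-< (ℚ.*-monoʳ-<-pos s x<B) (ℚ.*-monoʳ-<-pos r y<B))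
           (ℚ.neg-antimono-< (ℚ.+-mono-< (0<η* δ<x) (0<η* δ<y))) ⟩
    (s ℚ.* B ℚ.+ r ℚ.* B) ℚ.+ 0ℚ
      ≡⟨ expand η t B ⟩
    B ℚ.+ (η ℚ.* B ℚ.+ η ℚ.* B)
      ≡⟨ cong (λ q → B ℚ.+ (q ℚ.+ q)) ηB≡ ⟩
    B ℚ.+ (½ ℚ.* (½ ℚ.* δ) ℚ.+ ½ ℚ.* (½ ℚ.* δ))
      ≡⟨ cong (B ℚ.+_) (half+half (½ ℚ.* δ)) ⟩
    B ℚ.+ ½ ℚ.* δ ∎
    where
    open ℚ.≤-Reasoning
    0<η* : ∀ {q} → δ ℚ.< q → 0ℚ ℚ.< η ℚ.* q
    0<η* {q} δ<q = ℚ.positive⁻¹ (η ℚ.* q)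
      {{ℚ.pos*pos⇒pos η q {{ℚ.positive (ℚ.<-trans δ>0 δ<q)}}}}
    expand : ∀ η t B → ((η ℚ.+ t) ℚ.* B ℚ.+ ((η ℚ.+ 1ℚ) ℚ.- t) ℚ.* B) ℚ.+ 0ℚ
      ≡ B ℚ.+ (η ℚ.* B ℚ.+ η ℚ.* B)
    expand = solve 3 (λ η t B →
      ((η :+ t) :* B :+ ((η :+ con 1ℚ) :- t) :* B) :+ con 0ℚ := B :+ (η :* B :+ η :* B)) refl
      where open +-*-Solver

divide : ∀ p B → 0ℚ ℚ.< p → 0ℚ ℚ.< B → ∃[ η ] (0ℚ ℚ.< η × η ℚ.* B ≡ p)
divide p B p>0 B>0 = p ℚ.* ℚ.1/ B ,
  ℚ.positive⁻¹ (p ℚ.* ℚ.1/ B) {{ℚ.pos*pos⇒pos p {{ℚ.positive p>0}} (ℚ.1/ B) {{ℚ.1/pos⇒pos B}}}} ,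
  trans (ℚ.*-assoc p (ℚ.1/ B) B)
    (trans (cong (p ℚ.*_) (ℚ.*-inverseˡ B)) (ℚ.*-identityʳ p))
  where
  instance
    B-pos : ℚ.Positive B
    B-pos = ℚ.positive B>0
    B-nonZero : ℚ.NonZero B
    B-nonZero = ℚ.pos⇒nonZero B

segment-inside : ∀ {m} (x y : ℝ^ m) (t : ℝ) (δ B η : ℚ) →
  0ℚ ℚ.< δ → 0ℚ ℚ.< η → η ℚ.* B ≡ ½ ℚ.* (½ ℚ.* δ) → 0ᴿ ≤ᴿ t → t ≤ᴿ 1ᴿ →
  Eventually (λ n → ∀ i → δ ℚ.< (x at n) i × (x at n) i ℚ.< B) →
  Eventually (λ n → ∀ i → δ ℚ.< (y at n) i × (y at n) i ℚ.< B) →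
  Orthant (λ i → t *ᴿ x i +ᴿ (1ᴿ -ᴿ t) *ᴿ y i)
segment-inside x y t δ B η δ>0 η>0 ηB≡ 0≤t t≤1 x∈ y∈ =
  ½ ℚ.* δ , B ℚ.+ ½ ℚ.* δ , half-pos δ>0 ,
  eventually-map inside (eventually-× (eventually-× x∈ y∈)
    (eventually-× (≤ᴿ⇒eventually 0ᴿ t 0≤t η>0) (≤ᴿ⇒eventually t 1ᴿ t≤1 η>0)))
  where
  inside : ∀ n → ((∀ i → δ ℚ.< (x at n) i × (x at n) i ℚ.< B) ×
                  (∀ i → δ ℚ.< (y at n) i × (y at n) i ℚ.< B)) ×
                 (0ℚ ℚ.< η ℚ.+ seq t n × seq t n ℚ.< η ℚ.+ 1ℚ) →
           ∀ i → ½ ℚ.* δ ℚ.< seq (t *ᴿ x i +ᴿ (1ᴿ -ᴿ t) *ᴿ y i) n ×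
                 seq (t *ᴿ x i +ᴿ (1ᴿ -ᴿ t) *ᴿ y i) n ℚ.< B ℚ.+ ½ ℚ.* δ
  inside n ((xs , ys) , 0<η+t , t<η+1) i =
    interpolation-lower δ η B (seq (x i) n) (seq (y i) n) (seq t n) δ>0 η>0 ηB≡
      (proj₁ (xs i)) (proj₂ (xs i)) (proj₁ (ys i)) (proj₂ (ys i)) 0<η+t t<η+1 ,
    interpolation-upper δ η B (seq (x i) n) (seq (y i) n) (seq t n) δ>0 η>0 ηB≡
      (proj₁ (xs i)) (proj₂ (xs i)) (proj₁ (ys i)) (proj₂ (ys i)) 0<η+t t<η+1

orthant-convex : ∀ {m} → Convex (Orthant {m})
orthant-convex {m} x y (δ₁ , B₁ , δ₁>0 , x∈) (δ₂ , B₂ , δ₂>0 , y∈) t 0≤t t≤1 =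
  segment-inside x y t δ B (proj₁ quotient) δ>0 (proj₁ (proj₂ quotient)) (proj₂ (proj₂ quotient))
    0≤t t≤1
    (widen x (ℚ.p⊓q≤p δ₁ δ₂) (ℚ.p≤p⊔q B₁ (B₂ ℚ.⊔ 1ℚ)) x∈)
    (widen y (ℚ.p⊓q≤q δ₁ δ₂)
      (ℚ.≤-trans (ℚ.p≤p⊔q B₂ 1ℚ) (ℚ.p≤q⊔p B₁ (B₂ ℚ.⊔ 1ℚ))) y∈)
  where
  δ B : ℚ
  δ = δ₁ ℚ.⊓ δ₂
  -- The maximum with `1ℚ` makes `B` positive and so a valid divisor; in dimension zero the given
  -- bounds can be negative.
  B = B₁ ℚ.⊔ (B₂ ℚ.⊔ 1ℚ)
  δ>0 : 0ℚ ℚ.< δ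
  δ>0 with ℚ.⊓-sel δ₁ δ₂
  ... | inj₁ eq = subst (0ℚ ℚ.<_) (sym eq) δ₁>0
  ... | inj₂ eq = subst (0ℚ ℚ.<_) (sym eq) δ₂>0
  B>0 : 0ℚ ℚ.< B
  B>0 = ℚ.<-≤-trans (ℚ.positive⁻¹ 1ℚ)
    (ℚ.≤-trans (ℚ.p≤q⊔p B₂ 1ℚ) (ℚ.p≤q⊔p B₁ (B₂ ℚ.⊔ 1ℚ)))
  quotient : ∃[ η ] (0ℚ ℚ.< η × η ℚ.* B ≡ ½ ℚ.* (½ ℚ.* δ))
  quotient = divide (½ ℚ.* (½ ℚ.* δ)) B (half-pos (half-pos δ>0)) B>0
  widen : ∀ (z : ℝ^ m) {δ′ B′} → δ ℚ.≤ δ′ → B′ ℚ.≤ B →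
    Eventually (λ n → ∀ i → δ′ ℚ.< (z at n) i × (z at n) i ℚ.< B′) →
    Eventually (λ n → ∀ i → δ ℚ.< (z at n) i × (z at n) i ℚ.< B)
  widen z δ≤δ′ B′≤B = eventually-map λ n bounds i →
    ℚ.≤-<-trans δ≤δ′ (proj₁ (bounds i)) , ℚ.<-≤-trans (proj₂ (bounds i)) B′≤B

-- Finitely many strict inequalities between reals hold termwise from
-- some index on, which reduces the bound to rational hyperplanes.
realization-bound : ∀ {c ℓ ℓ₁} {U : Setoid c ℓ} {𝒮 : Pred (Subset U) ℓ₁} {m} →
  Realization 𝒮 m → ∀ {k} (v : Fin k → Setoid.Carrier U) (S : Vec Bool k → Subset U) →
  (∀ s → 𝒮 (S s)) → (∀ s i → Vec.lookup s i ≡ true  → v i ∈ S s) →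
  (∀ s i → Vec.lookup s i ≡ false → v i ∉ S s) → k ℕ.≤ m
realization-bound {m = m} R {k} v S 𝒮S inside outside =
  separated⇒≤ (λ i → a (v i) at N) (λ i → seq (b (v i)) N) (λ s → x s at N)
    (λ s i eq → proj₁ (holds s i) eq) (λ s i eq → proj₂ (holds s i) eq)
  where
  open Realization R
  witness : ∀ s → _
  witness s = Equivalence.to (realizes (S s)) (𝒮S s)
  x : Vec Bool k → ℝ^ m
  x s = proj₁ (witness s)
  Side : Vec Bool k → Fin k → ℕ → Set
  Side s i n =
    (Vec.lookup s i ≡ true → seq (b (v i)) n ℚ.< (a (v i) at n) ∙ (x s at n)) ×
    (Vec.lookup s i ≡ false → (a (v i) at n) ∙ (x s at n) ℚ.< seq (b (v i)) n)
  side : ∀ s i → Eventually (Side s i)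
  side s i with Vec.lookup s i in eq
  ... | true = eventually-map
    (λ n lt → (λ _ → subst (seq (b (v i)) n ℚ.<_) (seq-· (a (v i)) (x s) n) lt) , λ ())
    (<ᴿ⇒eventually {b (v i)} {a (v i) · x s}
      (proj₁ (proj₂ (proj₂ (witness s))) (v i) (inside s i eq)))
  ... | false = eventually-map
    (λ n lt → (λ ()) , λ _ → subst (ℚ._< seq (b (v i)) n) (seq-· (a (v i)) (x s) n) lt)
    (<ᴿ⇒eventually {a (v i) · x s} {b (v i)}
      (proj₂ (proj₂ (proj₂ (witness s))) (v i) (outside s i eq)))
  common : Eventually (λ n → ∀ s i → Side s i n)
  common = eventually-∀Vec (λ s → eventually-∀Fin (side s))
  N = proj₁ common
  holds : ∀ s i → Side s i N
  holds = proj₂ common N ℕ.≤-refl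

-- Ideals of a finite poset

count : ∀ {a p} {A : Set a} {P : Pred A p} → Unary.Decidable P → List A → ℕ
count P? xs = length (filter P? xs)

module _ {a p q} {A : Set a} {P : Pred A p} {Q : Pred A q}
         (P? : Unary.Decidable P) (Q? : Unary.Decidable Q) where

  count-mono : ∀ xs → (∀ x → P x → Q x) → count P? xs ℕ.≤ count Q? xs
  count-mono [] P⇒Q = z≤n
  count-mono (x ∷ xs) P⇒Q with P? x | Q? x
  ... | yes _ | yes _ = s≤s (count-mono xs P⇒Q)
  ... | yes p | no ¬q = contradiction (P⇒Q x p) ¬q
  ... | no  _ | yes _ = ℕ.m≤n⇒m≤1+n (count-mono xs P⇒Q)
  ... | no  _ | no  _ = count-mono xs P⇒Q

  count-disjoint : ∀ xs → (∀ {x} → x ∈ˡ xs → P x → ¬ Q x) →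
                   count P? xs ℕ.+ count Q? xs ℕ.≤ length xs
  count-disjoint [] disjoint = z≤n
  count-disjoint (x ∷ xs) disjoint with P? x | Q? x
  ... | yes p | yes q = contradiction q (disjoint (here refl) p)
  ... | yes _ | no  _ = s≤s (count-disjoint xs (disjoint ∘ there))
  ... | no  _ | yes _ = subst (ℕ._≤ suc (length xs)) (sym (ℕ.+-suc (count P? xs) (count Q? xs)))
                          (s≤s (count-disjoint xs (disjoint ∘ there)))
  ... | no  _ | no  _ = ℕ.m≤n⇒m≤1+n (count-disjoint xs (disjoint ∘ there))

  count-cover : ∀ xs → (∀ {x} → x ∈ˡ xs → P x ⊎ Q x) →
                length xs ℕ.≤ count P? xs ℕ.+ count Q? xs
  count-cover [] cover = z≤n
  count-cover (x ∷ xs) cover with P? x | Q? x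
  ... | no ¬p | no ¬q = contradiction (cover (here refl)) [ ¬p , ¬q ]′
  ... | yes _ | no  _ = s≤s (count-cover xs (cover ∘ there))
  ... | no  _ | yes _ = subst (suc (length xs) ℕ.≤_) (sym (ℕ.+-suc (count P? xs) (count Q? xs)))
                          (s≤s (count-cover xs (cover ∘ there)))
  ... | yes _ | yes _ = s≤s (ℕ.≤-trans (count-cover xs (cover ∘ there))
                          (ℕ.+-monoʳ-≤ (count P? xs) (ℕ.n≤1+n (count Q? xs))))

  -- Inclusion and exclusion: `y` is counted twice.
  count-overlap : ∀ {y} xs → (∀ {x} → x ∈ˡ xs → P x ⊎ Q x) → y ∈ˡ xs → P y → Q y →
                  length xs ℕ.< count P? xs ℕ.+ count Q? xs
  count-overlap (x ∷ xs) cover (here refl) p q with P? x | Q? x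
  ... | yes _ | yes _ = s≤s (subst (suc (length xs) ℕ.≤_) (sym (ℕ.+-suc (count P? xs) (count Q? xs)))
                          (s≤s (count-cover xs (cover ∘ there))))
  ... | no ¬p | _     = contradiction p ¬p
  ... | yes _ | no ¬q = contradiction q ¬q
  count-overlap (x ∷ xs) cover (there y∈) p q with P? x | Q? x
  ... | no ¬p | no ¬q = contradiction (cover (here refl)) [ ¬p , ¬q ]′
  ... | yes _ | no  _ = s≤s (count-overlap xs (cover ∘ there) y∈ p q)
  ... | no  _ | yes _ = subst (suc (suc (length xs)) ℕ.≤_) (sym (ℕ.+-suc (count P? xs) (count Q? xs)))
                          (s≤s (count-overlap xs (cover ∘ there) y∈ p q))
  ... | yes _ | yes _ = s≤s (ℕ.≤-trans (count-overlap xs (cover ∘ there) y∈ p q)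
                          (ℕ.+-monoʳ-≤ (count P? xs) (ℕ.n≤1+n (count Q? xs))))

-- Sums of natural numbers and their embedding in the rationals

n<2n : ∀ n → 1 ℕ.≤ n → n ℕ.< 2 ℕ.* n
n<2n n 1≤n = ℕ.m<m+n n (ℕ.≤-trans 1≤n (ℕ.m≤m+n n 0))

term≤sum : ∀ {k} (f : Fin k → ℕ) i → f i ℕ.≤ ∑ℕ.sum f
term≤sum f zero    = ℕ.m≤m+n (f zero) _
term≤sum f (suc i) = ℕ.≤-trans (term≤sum (f ∘ suc) i) (ℕ.m≤n+m _ (f zero))

sum≤ : ∀ {k} (f : Fin k → ℕ) {B} → (∀ i → f i ℕ.≤ B) → ∑ℕ.sum f ℕ.≤ k ℕ.* B
sum≤ {zero}  f f≤B = z≤n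
sum≤ {suc k} f f≤B = ℕ.+-mono-≤ (f≤B zero) (sum≤ (f ∘ suc) (f≤B ∘ suc))

-- Written as a multiple of `1ℚ`, so that the homomorphism laws for sums and products apply.
ι : ℕ → ℚ
ι n = n ℚ×.× 1ℚ

ι-mono-≤ : ∀ {m n} → m ℕ.≤ n → ι m ℚ.≤ ι n
ι-mono-≤ {n = zero}  z≤n = ℚ.≤-refl
ι-mono-≤ {n = suc n} z≤n =
  ℚ.+-mono-≤ (ℚ.<⇒≤ (ℚ.positive⁻¹ 1ℚ)) (ι-mono-≤ {n = n} z≤n)
ι-mono-≤ {suc m} {suc n} (s≤s m≤n) = ℚ.+-monoʳ-≤ 1ℚ (ι-mono-≤ {m} {n} m≤n)

ι-mono-< : ∀ {m n} → m ℕ.< n → ι m ℚ.< ι n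
ι-mono-< {m} {n} m<n = ℚ.<-≤-trans
  (subst (ℚ._< ι (suc m)) (ℚ.+-identityˡ (ι m)) (ℚ.+-monoˡ-< (ι m) (ℚ.positive⁻¹ 1ℚ)))
  (ι-mono-≤ {suc m} {n} m<n)

ι-sum : ∀ {k} (f : Fin k → ℕ) → ∑.sum (λ i → ι (f i)) ≡ ι (∑ℕ.sum f)
ι-sum {zero}  f = refl
ι-sum {suc k} f = trans (cong (ι (f zero) ℚ.+_) (ι-sum (f ∘ suc)))
  (sym (ℚ×.×-homo-+ 1ℚ (f zero) (∑ℕ.sum (f ∘ suc))))

≈ᴿ-reflexive : ∀ p q → p ≡ q → fromℚ p ≈ᴿ fromℚ q
≈ᴿ-reflexive p _ refl ε ε>0 =
  0 , λ n _ → subst (λ r → ∣ r ∣ ℚ.< ε) (sym (ℚ.+-inverseʳ p)) ε>0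

ι-≉0 : ∀ n → 1 ℕ.≤ n → ¬ fromℚ (ι n) ≈ᴿ 0ᴿ
ι-≉0 n 1≤n ι≈0 with ι≈0 1ℚ (ℚ.positive⁻¹ 1ℚ)
... | N , close = ℚ.<-irrefl refl (ℚ.≤-<-trans (ι-mono-≤ {1} {n} 1≤n)
  (subst (ℚ._< 1ℚ) (ℚ.+-identityʳ (ι n)) (ℚ.≤-<-trans (p≤∣p∣ (ι n ℚ.- 0ℚ)) (close N ℕ.≤-refl))))

-- `xs` contains every element up to `_≈_` only, so elements are replaced by their representatives
-- through `complete`.
module FinitePoset {c ℓ₁ ℓ₂} (P : Poset c ℓ₁ ℓ₂)
  (_≤?_ : Decidable (Poset._≤_ P)) (xs : List (Poset.Carrier P))
  (complete : ∀ e → ∃[ x ] (x ∈ˡ xs × Poset._≈_ P x e)) where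

  open Poset P using (Carrier; _≈_; _≤_; module Eq; antisym; reflexive)
    renaming (refl to ≤-refl; trans to ≤-trans)
  open Dilworth _≤_ ≤-refl ≤-trans _≤?_

  U = Eq.setoid

  _≈?_ : Decidable _≈_
  x ≈? y = map′ (λ (p , q) → antisym p q) (λ eq → reflexive eq , reflexive (Eq.sym eq))
                ((x ≤? y) ×-dec (y ≤? x))

  -- Generated ideals, antichains and shattered sets

  comprehension : ∀ {q} (Q : Pred Carrier q) → Unary.Decidable Q → Q Respects _≈_ → Subset U
  comprehension Q Q? Q-resp = record
    { to   = λ e → ⌊ Q? e ⌋
    ; cong = λ {e} {f} e≈f → trans (isYes≗does (Q? e))
        (trans (does-⇔ (mk⇔ (Q-resp e≈f) (Q-resp (Eq.sym e≈f))) (Q? e) (Q? f))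
               (sym (isYes≗does (Q? f))))
    }

  ∈-resp : (X : Subset U) → (_∈ X) Respects _≈_
  ∈-resp X e≈f = subst T (Func.cong X e≈f)

  generated : ∀ {k q} (v : Fin k → Carrier) {Q : Pred (Fin k) q} → Unary.Decidable Q → Subset U
  generated v {Q} Q? = comprehension (λ e → ∃[ j ] (Q j × e ≤ v j))
    (λ e → Fin.any? (λ j → Q? j ×-dec (e ≤? v j)))
    (λ e≈f (j , Qj , e≤vj) → j , Qj , ≤-trans (reflexive (Eq.sym e≈f)) e≤vj)

  module _ {k q} (v : Fin k → Carrier) {Q : Pred (Fin k) q} (Q? : Unary.Decidable Q) where

    ∈-generated⁺ : ∀ {e} j → Q j → e ≤ v j → e ∈ generated v Q?
    ∈-generated⁺ j Qj e≤vj = fromWitness (j , Qj , e≤vj)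

    ∈-generated⁻ : ∀ {e} → e ∈ generated v Q? → ∃[ j ] (Q j × e ≤ v j)
    ∈-generated⁻ = toWitness

    generated-ideal : Ideals P (generated v Q?)
    generated-ideal e f e≤f f∈ =
      let j , Qj , f≤vj = ∈-generated⁻ f∈ in ∈-generated⁺ j Qj (≤-trans e≤f f≤vj)

    -- Of the members of an antichain, an ideal contains only those that were chosen to generate it.
    -- Hence ideals cut out every subset of an antichain.
    antichain-∈-generated : (∀ i j → v i ≤ v j → i ≡ j) → ∀ i → v i ∈ generated v Q? → Q i
    antichain-∈-generated v-antichain i vi∈ =
      let j , Qj , vi≤vj = ∈-generated⁻ vi∈ in subst Q (sym (v-antichain i j vi≤vj)) Qj

  -- A subset `Y` of the antichain is cut out by the ideal that its members generate.
  antichain⇒shattered : ∀ {k} → Antichain k xs →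
                        ∃[ X ] (HasSize {U = U} X k × Shatters (Ideals P) X)
  antichain⇒shattered {k} (v , _ , v-antichain) = X , size , shattered
    where
    X : Subset U
    X = comprehension (λ e → ∃[ j ] e ≈ v j) (λ e → Fin.any? (λ j → e ≈? v j))
          (λ e≈f (j , e≈vj) → j , Eq.trans (Eq.sym e≈f) e≈vj)
    index : ∀ e → e ∈ X → ∃[ j ] e ≈ v j
    index e = toWitness
    v∈X : ∀ j → v j ∈ X
    v∈X j = fromWitness (j , Eq.refl)
    v-injective : ∀ i j → v i ≈ v j → i ≡ j
    v-injective i j eq = v-antichain i j (reflexive eq)
    size : HasSize X k
    size = record
      { to        = λ j → v j , v∈X j
      ; from      = λ (e , e∈X) → proj₁ (index e e∈X)
      ; to-cong   = λ { refl → Eq.refl }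
      ; from-cong = λ { {e , e∈X} {f , f∈X} e≈f → v-injective _ _
          (Eq.trans (Eq.sym (proj₂ (index e e∈X))) (Eq.trans e≈f (proj₂ (index f f∈X)))) }
      ; inverse   = (λ { {e , e∈X} refl → Eq.sym (proj₂ (index e e∈X)) })
                  , λ { {j} {e , e∈X} e≈vj → v-injective _ _
                      (Eq.trans (Eq.sym (proj₂ (index e e∈X))) e≈vj) }
      }
    shattered : Shatters (Ideals P) X
    shattered Y = mk⇔
      (λ (S , _ , S∩X≐Y) e e∈Y →
        proj₂ (Equivalence.to T-∧ (Equivalence.from (S∩X≐Y e) e∈Y)))
      (λ Y⊆X → generated v Y? , generated-ideal v Y? , λ e → mk⇔
        (λ e∈ → let e∈S , e∈X = Equivalence.to T-∧ e∈
                    j , e≈vj = index e e∈X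
                in ∈-resp Y (Eq.sym e≈vj)
                     (antichain-∈-generated v Y? v-antichain j (∈-resp (generated v Y?) e≈vj e∈S)))
        (λ e∈Y → let j , e≈vj = index e (Y⊆X e e∈Y)
                 in Equivalence.from T-∧
                      ( ∈-generated⁺ v Y? j (∈-resp Y e≈vj e∈Y) (reflexive e≈vj)
                      , Y⊆X e e∈Y)))
      where
      Y? : Unary.Decidable (λ j → v j ∈ Y)
      Y? j = T? _

  -- An ideal that cuts out the single element `f j` contains all of `X` below `f j`, so no other
  -- element of `X` lies there.
  shattered⇒antichain : ∀ X k → HasSize {U = U} X k → Shatters (Ideals P) X → Antichain k xs
  shattered⇒antichain X k size shattered = v , v∈xs , v-antichain
    where
    module size = Inverse size
    f : Fin k → Carrier
    f i = proj₁ (size.to i)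
    f∈X : ∀ i → f i ∈ X
    f∈X i = proj₂ (size.to i)
    f-injective : ∀ i j → f i ≈ f j → i ≡ j
    f-injective i j eq = trans (sym (size.strictlyInverseʳ i))
      (trans (size.from-cong {size.to i} {size.to j} eq) (size.strictlyInverseʳ j))
    f-antichain : ∀ i j → f i ≤ f j → i ≡ j
    f-antichain i j fi≤fj = f-injective i j (toWitness fi∈Y)
      where
      Y : Subset U
      Y = comprehension (_≈ f j) (_≈? f j) (λ e≈e′ e≈fj → Eq.trans (Eq.sym e≈e′) e≈fj)
      cut : ∃[ S ] (Ideals P S × (S ∩ X) ≐ Y)
      cut = Equivalence.from (shattered Y)
        λ e e∈Y → ∈-resp X (Eq.sym (toWitness e∈Y)) (f∈X j)
      S = proj₁ cut
      fj∈S : f j ∈ S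
      fj∈S = proj₁ (Equivalence.to T-∧
        (Equivalence.from (proj₂ (proj₂ cut) (f j)) (fromWitness Eq.refl)))
      fi∈Y : f i ∈ Y
      fi∈Y = Equivalence.to (proj₂ (proj₂ cut) (f i)) (Equivalence.from T-∧
        (proj₁ (proj₂ cut) (f i) (f j) fi≤fj fj∈S , f∈X i))
    v : Fin k → Carrier
    v i = proj₁ (complete (f i))
    v∈xs : ∀ i → v i ∈ˡ xs
    v∈xs i = proj₁ (proj₂ (complete (f i)))
    v≈f : ∀ i → v i ≈ f i
    v≈f i = proj₂ (proj₂ (complete (f i)))
    v-antichain : ∀ i j → v i ≤ v j → i ≡ j
    v-antichain i j p = f-antichain i j
      (≤-trans (reflexive (Eq.sym (v≈f i))) (≤-trans p (reflexive (v≈f j))))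

  -- Each sign vector on the antichain is the trace of the ideal generated by the members marked
  -- `true`.
  antichain⇒≤dimension : ∀ {k m} → Antichain k xs → Realization (Ideals P) m → k ℕ.≤ m
  antichain⇒≤dimension {k} (v , _ , v-antichain) R = realization-bound R v
    (λ s → generated v (Q? s))
    (λ s → generated-ideal v (Q? s))
    (λ s i eq → ∈-generated⁺ v (Q? s) i eq ≤-refl)
    (λ s i eq vi∈ → contradiction
      (trans (sym (antichain-∈-generated v (Q? s) v-antichain i vi∈)) eq) (λ ()))
    where
    Q? : ∀ (s : Vec Bool k) → Unary.Decidable (λ j → Vec.lookup s j ≡ true)
    Q? s j = Vec.lookup s j Bool.≟ true

  -- A realization from a cover by chains

  module _ {d : ℕ} (χ : Carrier → ℕ) (χ<d : ∀ {x} → x ∈ˡ xs → χ x ℕ.< d)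
           (χ-chain : ∀ {x y} → x ∈ˡ xs → y ∈ˡ xs → χ x ≡ χ y → x ≤ y ⊎ y ≤ x) where

    -- Since `M` exceeds `2 * d`, even `d` terms `2 * M ^ N` stay below `M ^ suc N`, while a single
    -- term of larger exponent passes it.
    N M : ℕ
    N = length xs
    M = suc (2 ℕ.* d)

    -- As an implication this also counts all entries off chain `i`, so the threshold is `N` for
    -- every chain, whatever its length.
    above? : ∀ (i : Fin d) e → Unary.Decidable (λ z → χ z ≡ toℕ i → e ≤ z)
    above? i e z = (χ z ℕ.≟ toℕ i) →-dec (e ≤? z)

    inside? : ∀ (i : Fin d) (X : Subset U) → Unary.Decidable (λ z → χ z ≡ toℕ i × z ∈ X)
    inside? i X z = (χ z ℕ.≟ toℕ i) ×-dec T? _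

    -- For e in X, the chain of e is covered by the elements above e and the
    -- elements of X, and e counts twice; for e outside the ideal X, no
    -- element of any chain counts twice. So α e i + κ X i exceeds N for
    -- some i exactly when e lies in X.
    α : Carrier → Fin d → ℕ
    α e i = count (above? i e) xs

    κ : Subset U → Fin d → ℕ
    κ X i = count (inside? i X) xs

    α-antitone : ∀ {e f} → e ≤ f → ∀ i → α f i ℕ.≤ α e i
    α-antitone {e} {f} e≤f i = count-mono (above? i f) (above? i e) xs
      (λ z f≤z eq → ≤-trans e≤f (f≤z eq))

    α-cong : ∀ {e f} → e ≈ f → ∀ i → α e i ≡ α f i
    α-cong e≈f i = ℕ.≤-antisym (α-antitone (reflexive (Eq.sym e≈f)) i) (α-antitone (reflexive e≈f) i)

    -- The colour is read off the representative in `xs`, because `χ` is controlled only there and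
    -- may not respect `_≈_`.
    chain-of : Carrier → Fin d
    chain-of e = fromℕ< (χ<d (proj₁ (proj₂ (complete e))))

    α+κ-∈ : ∀ X → Ideals P X → ∀ e → e ∈ X → N ℕ.< α e (chain-of e) ℕ.+ κ X (chain-of e)
    α+κ-∈ X X-ideal e e∈X = count-overlap (above? i e) (inside? i X) xs cover r∈xs
      (λ _ → reflexive (Eq.sym r≈e)) (χr≡i , r∈X)
      where
      i = chain-of e
      r = proj₁ (complete e)
      r∈xs = proj₁ (proj₂ (complete e))
      r≈e : r ≈ e
      r≈e = proj₂ (proj₂ (complete e))
      r∈X : r ∈ X
      r∈X = ∈-resp X (Eq.sym r≈e) e∈X
      χr≡i : χ r ≡ toℕ i
      χr≡i = sym (Fin.toℕ-fromℕ< _)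
      cover : ∀ {z} → z ∈ˡ xs → (χ z ≡ toℕ i → e ≤ z) ⊎ (χ z ≡ toℕ i × z ∈ X)
      cover {z} z∈xs with χ z ℕ.≟ toℕ i
      ... | no  ≢i = inj₁ (λ ≡i → contradiction ≡i ≢i)
      ... | yes ≡i with χ-chain r∈xs z∈xs (trans χr≡i (sym ≡i))
      ...   | inj₁ r≤z = inj₁ (λ _ → ≤-trans (reflexive (Eq.sym r≈e)) r≤z)
      ...   | inj₂ z≤r = inj₂ (≡i , X-ideal z r z≤r r∈X)

    α+κ-∉ : ∀ X → Ideals P X → ∀ e → e ∉ X → ∀ i → α e i ℕ.+ κ X i ℕ.≤ N
    α+κ-∉ X X-ideal e e∉X i = count-disjoint (above? i e) (inside? i X) xs
      λ {z} _ e≤z (≡i , z∈X) → e∉X (X-ideal e z (e≤z ≡i) z∈X)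

    normal : Carrier → ℝ^ d
    normal e i = fromℚ (ι (M ℕ.^ α e i))

    offset : ℝ
    offset = fromℚ (ι (M ℕ.^ suc N))

    -- The factor 2 keeps the inequality strict when the largest exponent is exactly `suc N`.
    point : Subset U → ℝ^ d
    point X i = fromℚ (ι (2 ℕ.* M ℕ.^ κ X i))

    -- This is the value of the functional of `e` at `point X`, kept in the natural numbers for the
    -- comparison with the offset.
    height : Carrier → Subset U → ℕ
    height e X = ∑ℕ.sum (λ i → 2 ℕ.* M ℕ.^ (α e i ℕ.+ κ X i))

    seq-height : ∀ e X n → seq (normal e · point X) n ≡ ι (height e X)
    seq-height e X n = begin
      seq (normal e · point X) n
        ≡⟨ seq-· (normal e) (point X) n ⟩
      ∑.sum (λ i → ι (M ℕ.^ α e i) ℚ.* ι (2 ℕ.* M ℕ.^ κ X i))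
        ≡⟨ ∑.sum-cong-≗ (λ i → trans
             (sym (ℚ×.×1-homo-* (M ℕ.^ α e i) (2 ℕ.* M ℕ.^ κ X i)))
             (cong ι (exponent (α e i) (κ X i)))) ⟩
      ∑.sum (λ i → ι (2 ℕ.* M ℕ.^ (α e i ℕ.+ κ X i)))
        ≡⟨ ι-sum (λ i → 2 ℕ.* M ℕ.^ (α e i ℕ.+ κ X i)) ⟩
      ι (height e X) ∎
      where
      open ≡-Reasoning
      exponent : ∀ a k → M ℕ.^ a ℕ.* (2 ℕ.* M ℕ.^ k) ≡ 2 ℕ.* M ℕ.^ (a ℕ.+ k)
      exponent a k = begin
        M ℕ.^ a ℕ.* (2 ℕ.* M ℕ.^ k)   ≡⟨ ℕ.*-assoc (M ℕ.^ a) 2 (M ℕ.^ k) ⟨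
        M ℕ.^ a ℕ.* 2 ℕ.* M ℕ.^ k     ≡⟨ cong (ℕ._* M ℕ.^ k) (ℕ.*-comm (M ℕ.^ a) 2) ⟩
        2 ℕ.* M ℕ.^ a ℕ.* M ℕ.^ k     ≡⟨ ℕ.*-assoc 2 (M ℕ.^ a) (M ℕ.^ k) ⟩
        2 ℕ.* (M ℕ.^ a ℕ.* M ℕ.^ k)   ≡⟨ cong (2 ℕ.*_) (ℕ.^-distribˡ-+-* M a k) ⟨
        2 ℕ.* M ℕ.^ (a ℕ.+ k)         ∎

    height-∈ : ∀ X → Ideals P X → ∀ e → e ∈ X → M ℕ.^ suc N ℕ.< height e X
    height-∈ X X-ideal e e∈X = begin-strict
      M ℕ.^ suc N                            <⟨ n<2n (M ℕ.^ suc N) (ℕ.m^n>0 M (suc N)) ⟩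
      2 ℕ.* M ℕ.^ suc N                      ≤⟨ ℕ.*-monoʳ-≤ 2 (ℕ.^-monoʳ-≤ M (α+κ-∈ X X-ideal e e∈X)) ⟩
      2 ℕ.* M ℕ.^ (α e i ℕ.+ κ X i)          ≤⟨ term≤sum (λ i → 2 ℕ.* M ℕ.^ (α e i ℕ.+ κ X i)) i ⟩
      height e X                             ∎
      where
      open ℕ.≤-Reasoning
      i = chain-of e

    height-∉ : ∀ X → Ideals P X → ∀ e → e ∉ X → height e X ℕ.< M ℕ.^ suc N
    height-∉ X X-ideal e e∉X = begin-strict
      height e X                             ≤⟨ sum≤ (λ i → 2 ℕ.* M ℕ.^ (α e i ℕ.+ κ X i))
                                                  (λ i → ℕ.*-monoʳ-≤ 2 (ℕ.^-monoʳ-≤ M (α+κ-∉ X X-ideal e e∉X i))) ⟩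
      d ℕ.* (2 ℕ.* M ℕ.^ N)                  ≡⟨ ℕ.*-assoc d 2 (M ℕ.^ N) ⟨
      d ℕ.* 2 ℕ.* M ℕ.^ N                    ≡⟨ cong (ℕ._* M ℕ.^ N) (ℕ.*-comm d 2) ⟩
      2 ℕ.* d ℕ.* M ℕ.^ N                    <⟨ ℕ.m<n+m (2 ℕ.* d ℕ.* M ℕ.^ N) (ℕ.m^n>0 M N) ⟩
      M ℕ.^ suc N                            ∎
      where open ℕ.≤-Reasoning

    point-∈ : ∀ X → Orthant (point X)
    -- Coordinates are at least 2, and at most `2 * M ^ N` because `κ` counts entries of `xs`.
    point-∈ X = ι 1 , ι (suc (2 ℕ.* M ℕ.^ N)) , ι-mono-< {0} {1} (s≤s z≤n) , 0 , λ n _ i →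
      ι-mono-< {1} {2 ℕ.* M ℕ.^ κ X i} (ℕ.*-monoʳ-≤ 2 (ℕ.m^n>0 M (κ X i))) ,
      ι-mono-< {2 ℕ.* M ℕ.^ κ X i} {suc (2 ℕ.* M ℕ.^ N)}
        (s≤s (ℕ.*-monoʳ-≤ 2 (ℕ.^-monoʳ-≤ M (List.length-filter (inside? i X) xs))))

    normal-cong : ∀ {e f} → e ≈ f → normal e ≈ᵛ normal f
    normal-cong {e} {f} e≈f i = ≈ᴿ-reflexive (ι (M ℕ.^ α e i)) (ι (M ℕ.^ α f i))
      (cong (λ k → ι (M ℕ.^ k)) (α-cong e≈f i))

    normal-≉0 : ∀ e → ¬ (normal e ≈ᵛ 0ᵛ)
    normal-≉0 e normal≈0 =
      -- All coordinates are positive, and `chain-of e` names one, so `d` is not zero once there is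
      -- an `e`.
      ι-≉0 (M ℕ.^ α e (chain-of e)) (ℕ.m^n>0 M (α e (chain-of e))) (normal≈0 (chain-of e))

    point-H⁺ : ∀ X → Ideals P X → ∀ e → e ∈ X → H⁺ (normal e) offset (point X)
    point-H⁺ X X-ideal e e∈X = const-<ᴿ {offset} {normal e · point X}
      {ι (M ℕ.^ suc N)} {ι (height e X)} (λ _ → refl) (seq-height e X)
      (ι-mono-< {M ℕ.^ suc N} {height e X} (height-∈ X X-ideal e e∈X))

    point-H⁻ : ∀ X → Ideals P X → ∀ e → e ∉ X → H⁻ (normal e) offset (point X)
    point-H⁻ X X-ideal e e∉X = const-<ᴿ {normal e · point X} {offset}
      {ι (height e X)} {ι (M ℕ.^ suc N)} (seq-height e X) (λ _ → refl)
      (ι-mono-< {height e X} {M ℕ.^ suc N} (height-∉ X X-ideal e e∉X))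

    Separated : Subset U → ℝ^ d → Set c
    Separated X x = Orthant x × (∀ e → e ∈ X → H⁺ (normal e) offset x)
                              × (∀ e → e ∉ X → H⁻ (normal e) offset x)

    ideal⇒separated : ∀ X → Ideals P X → ∃[ x ] Separated X x
    ideal⇒separated X X-ideal =
      point X , point-∈ X , point-H⁺ X X-ideal , point-H⁻ X X-ideal

    -- On the orthant e ≤ f makes normal e · x dominate normal f · x, so
    -- every cell there is an ideal.
    separated⇒ideal : ∀ X → ∃[ x ] Separated X x → Ideals P X
    separated⇒ideal X (x , (δ , B , δ>0 , x∈) , pos , neg) e f e≤f f∈X =
      -- Membership is decidable, so refuting `e ∉ X` suffices; one late index turns this into a
      -- comparison of rationals.
      decidable-stable (T? _) λ e∉X → impossible (eventually-× x∈ (eventually-×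
        (<ᴿ⇒eventually {normal e · x} {offset} (neg e e∉X))
        (<ᴿ⇒eventually {offset} {normal f · x} (pos f f∈X))))
      where
      impossible : ¬ Eventually (λ n → (∀ i → δ ℚ.< (x at n) i × (x at n) i ℚ.< B) ×
        seq (normal e · x) n ℚ.< seq offset n × seq offset n ℚ.< seq (normal f · x) n)
      impossible (n , holds) with holds n ℕ.≤-refl
      ... | bounds , below , above = ℚ.<-irrefl refl
        (ℚ.<-≤-trans (ℚ.<-trans below above)
          (subst₂ ℚ._≤_ (sym (seq-· (normal f) x n)) (sym (seq-· (normal e) x n))
            (∑-mono-≤ (λ i → ι (M ℕ.^ α f i) ℚ.* (x at n) i) (λ i → ι (M ℕ.^ α e i) ℚ.* (x at n) i)
              λ i → ℚ.*-monoʳ-≤-nonNeg ((x at n) i)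
                {{ℚ.nonNegative (ℚ.<⇒≤ (ℚ.<-trans δ>0 (proj₁ (bounds i))))}}
                (ι-mono-≤ {M ℕ.^ α f i} {M ℕ.^ α e i} (ℕ.^-monoʳ-≤ M (α-antitone e≤f i))))))

    realization : Realization (Ideals P) d
    realization = record
      { a              = normal
      ; b              = λ _ → offset
      ; a-cong         = normal-cong
      ; b-cong         = λ _ → ≈ᴿ-reflexive (ι (M ℕ.^ suc N)) (ι (M ℕ.^ suc N)) refl
      ; a≉0            = normal-≉0
      ; K              = Orthant
      ; K-resp         = λ {x} {y} → orthant-resp {x = x} {y}
      ; K-convex       = orthant-convex
      ; K-relativeOpen = orthant-open
      ; realizes       = λ X → mk⇔ (ideal⇒separated X) (separated⇒ideal X)
      }

  dimensions : ∃[ d ] (IsVCDimension (Ideals P) d × IsEuclideanDimension (Ideals P) d)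
  dimensions with dilworth-width xs
  ... | d , anti , ¬anti , χ , χ<d , χ-chain = d ,
    (antichain⇒shattered anti , λ X k size shattered →
      ℕ.≮⇒≥ λ d<k → ¬anti (antichain-shrink d<k (shattered⇒antichain X k size shattered))) ,
    (realization χ χ<d χ-chain , λ m R → antichain⇒≤dimension anti R)

-- Finite lattices

-- The listed proof of `Q x` may differ from the given one, so a proof is returned along with the
-- membership.
list-satisfying : ∀ {a q} {A : Set a} {Q : Pred A q} → Unary.Decidable Q → ∀ xs →
  ∃[ ys ] (∀ {x} → x ∈ˡ xs → Q x → Σ (Q x) λ q → (x , q) ∈ˡ ys)
list-satisfying Q? [] = [] , λ ()
list-satisfying Q? (x ∷ xs) with Q? x | list-satisfying Q? xs
... | yes q | ys , ys-complete = (x , q) ∷ ys , λ where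
  (here refl) _  → q , here refl
  (there y∈)  q′ → let q″ , y∈ys = ys-complete y∈ q′ in q″ , there y∈ys
... | no ¬q | ys , ys-complete = ys , λ where
  (here refl) q → contradiction q ¬q
  (there y∈)  q → ys-complete y∈ q

module _ {c ℓ₁ ℓ₂} (L : FiniteDistributiveLattice c ℓ₁ ℓ₂) where
  open FiniteDistributiveLattice L hiding (refl; trans)
  open FiniteDistributiveLattice L using () renaming (refl to ≤-refl; trans to ≤-trans)
  open JoinSemilattice joinSemilattice using (∨-cong)
  private
    module enum = Inverse enumeration

  _≟_ : Decidable _≈_
  x ≟ y = map′
    (λ eq → Eq.trans (Eq.sym (enum.strictlyInverseˡ x))
      (Eq.trans (Eq.reflexive (cong enum.to eq))
        (enum.strictlyInverseˡ y)))
    enum.from-cong (enum.from x Fin.≟ enum.from y)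

  -- The order is reduced to equality: `x ≤ y` amounts to `x ∧ y ≈ x`.
  _≤?_ : Decidable _≤_
  x ≤? y = map′
    (λ eq → ≤-trans (reflexive (Eq.sym eq)) (x∧y≤y x y))
    (λ x≤y → antisym (x∧y≤x x y) (∧-greatest ≤-refl x≤y))
    ((x ∧ y) ≟ x)

  all-elements? : ∀ {q} {Q : Pred Carrier q} → Q Respects _≈_ → Unary.Decidable Q →
                  Dec (∀ x → Q x)
  all-elements? Q-resp Q? = map′
    (λ all x → Q-resp (enum.strictlyInverseˡ x) (all (enum.from x)))
    (λ all i → all (enum.to i))
    (Fin.all? (λ i → Q? (enum.to i)))

  joinIrreducible? : Unary.Decidable (JoinIrreducible L)
  joinIrreducible? j =
    ¬? (all-elements? (λ x≈y j≤x → ≤-trans j≤x (reflexive x≈y)) (j ≤?_)) ×-dec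
    all-elements?
      (λ x≈x′ all y j≈x′∨y → Sum.map (λ eq → Eq.trans eq x≈x′) id
        (all y (Eq.trans j≈x′∨y (∨-cong (Eq.sym x≈x′) Eq.refl))))
      λ x → all-elements?
        (λ y≈y′ irr j≈x∨y′ → Sum.map id (λ eq → Eq.trans eq y≈y′)
          (irr (Eq.trans j≈x∨y′ (∨-cong Eq.refl (Eq.sym y≈y′)))))
        λ y → (j ≟ (x ∨ y)) →-dec ((j ≟ x) ⊎-dec (j ≟ y))

  joinIrreducible-resp : JoinIrreducible L Respects _≈_
  joinIrreducible-resp j≈k (¬min , irr) =
    (λ min → ¬min λ x → ≤-trans (reflexive j≈k) (min x)) ,
    λ x y k≈x∨y → Sum.map (Eq.trans (Eq.sym j≈k)) (Eq.trans (Eq.sym j≈k))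
      (irr x y (Eq.trans j≈k k≈x∨y))

  -- An irreducible `e` is represented by its equal in the enumeration, to which irreducibility
  -- carries over.
  irreducibles : Σ (List (Σ Carrier (JoinIrreducible L))) λ js →
                 ∀ e → ∃[ x ] (x ∈ˡ js × proj₁ x ≈ proj₁ e)
  irreducibles with list-satisfying joinIrreducible? (List.map enum.to (List.allFin size))
  ... | js , js-complete = js , λ (e , e-irr) →
    let irr , e∈js = js-complete (∈-map⁺ enum.to (∈-allFin (enum.from e)))
                       (joinIrreducible-resp (Eq.sym (enum.strictlyInverseˡ e)) e-irr)
    in (enum.to (enum.from e) , irr) , e∈js , enum.strictlyInverseˡ e

corollary38 : ∀ {c ℓ₁ ℓ₂} (L : FiniteDistributiveLattice c ℓ₁ ℓ₂) →
    ∃[ d ] (IsVCDimension (birkhoffFamily L) d × IsEuclideanDimension (birkhoffFamily L) d)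
corollary38 L = FinitePoset.dimensions (joinIrreducibles L) (λ x y → _≤?_ L (proj₁ x) (proj₁ y))
  (proj₁ (irreducibles L)) (proj₂ (irreducibles L))
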